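{- Let $A$ and $B$ be finite sets of real numbers. Then the number of triples $(a,b,c)$ with $a\in A$, $b\in B$, $c\in A\cup B$, and $a+b=2c$ is at most $0.15(|A|+|B|)^2+0.5(|A|+|B|)$. -}

module Defs where

open import Level using (0ℓ)
open import Data.Nat as ℕ using (ℕ)
open import Data.Product using (Σ; ∃; _×_; _,_)
open import Data.Sum using (_⊎_)
open import Data.List using (List; []; _∷_; _++_; length; filter; cartesianProduct; deduplicate)
open import Algebra.Core using (Op₁; Op₂)
open import Algebra.Structures using (IsCommutativeRing)
open import Relation.Binary.Core using (Rel)
open import Relation.Binary.Structures using (IsStrictTotalOrder)
open import Relation.Binary.PropositionalEquality using (_≡_)
open import Relation.Nullary using (¬_)

-- An axiomatisation of the real numbers: a Dedekind-complete ordered field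
-- (with propositional equality as equality).  Every model is isomorphic to ℝ;
-- the theorem is stated for every such model.
record RealField : Set₁ where
  infixl 7 _*_
  infixl 6 _+_
  infix 4 _<_ _≤_
  field
    Carrier           : Set
    _+_ _*_           : Op₂ Carrier
    -_                : Op₁ Carrier
    0# 1#             : Carrier
    isCommutativeRing : IsCommutativeRing _≡_ _+_ _*_ -_ 0# 1#
    0≢1               : ¬ (0# ≡ 1#)
    inv               : (x : Carrier) → ¬ (x ≡ 0#) → Carrier
    inv-inverse       : (x : Carrier) (p : ¬ (x ≡ 0#)) → x * inv x p ≡ 1#
    _<_               : Rel Carrier 0ℓ
    isStrictTotalOrder : IsStrictTotalOrder _≡_ _<_
    +-mono-<          : ∀ {x y} z → x < y → x + z < y + z
    *-pos             : ∀ {x y} → 0# < x → 0# < y → 0# < x * y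

  _≤_ : Rel Carrier 0ℓ
  x ≤ y = x < y ⊎ x ≡ y

  field
    sup : (P : Carrier → Set) → ∃ P → (∃ λ u → ∀ x → P x → x ≤ u) →
          ∃ λ s → (∀ x → P x → x ≤ s) × (∀ u → (∀ x → P x → x ≤ u) → s ≤ u)

  open IsStrictTotalOrder isStrictTotalOrder public using (_≟_)

module _ (ℝ : RealField) where
  open RealField ℝ

  union : List Carrier → List Carrier → List Carrier
  union A B = deduplicate _≟_ (A ++ B)

  tripleCount : List Carrier → List Carrier → ℕ
  tripleCount A B =
    length (filter (λ { (a , (b , c)) → (a + b) ≟ (c + c) })
                   (cartesianProduct A (cartesianProduct B (union A B))))

module Submission where

-- Label the points of A ∪ B by integers so that the relations a + b = 2c are
-- preserved and both parities occur: these relations are rational linear equations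
-- with a nonconstant real solution, hence with a nonconstant integer one, which is
-- halved as long as all differences are even.  In a triple, a and b have the same
-- parity, and if both are even they agree mod 4 exactly when c is even.
--
-- Shift the labels so that the odd points, z of them counted with multiplicity, are
-- the minority, and let N be the number of even ones.  There are at most z²/4
-- triples with a, b odd.  Those with a, b, c even are bounded by induction, and also
-- by the number of pairs congruent mod 4.  When a, b are even and c is odd, (a , b)
-- lies in one of two grids (class 0 × class 2 and class 2 × class 0 mod 4).  In a grid
-- A × B the row of max A and the column of min B form a hook with pairwise distinct
-- sums, so it contains at most |C| solutions of a + b = 2c with c ∈ C; peeling off k
-- hooks leaves the bound k |C| + (|A| - k) (|B| - k).  The best k gives the theorem,
-- unless the classes mod 4 are so unbalanced that the inductive bound does.  The
-- extremal configuration has N = 4z.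

open import Defs
open import Algebra.Bundles using (CommutativeRing)
open import Algebra.Structures using (IsCommutativeRing)
import Algebra.Properties.CommutativeSemigroup
import Algebra.Properties.Ring
import Algebra.Solver.Ring.NaturalCoefficients.Default as SemiringSolver
open import Data.Bool as Bool using (Bool; true; false; if_then_else_; not; _xor_)
open import Data.Bool.Properties using (not-injective)
open import Data.Fin using (Fin; zero; suc)
import Data.Fin.Properties as FinP
open import Data.Integer as I using (ℤ; +_; -[1+_]; 0ℤ; 1ℤ; _⊖_)
import Data.Integer.DivMod as ℤD
import Data.Integer.Properties as ℤP
import Data.Integer.Tactic.RingSolver as ℤSolver
open import Data.List using (List; []; _∷_; _++_; length; map; filter; cartesianProduct; lookup; allFin)
open import Data.List.Membership.Propositional using (_∈_; find; lose)
open import Data.List.Membership.Propositional.Properties using (∈-map⁺; ∈-map⁻; ∈-filter⁺; ∈-filter⁻; ∈-cartesianProduct⁺; ∈-allFin; ∈-lookup; ∈-++⁺ˡ; ∈-++⁺ʳ; ∈-++⁻; ∈-deduplicate⁻)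
open import Data.List.Properties using (map-++; map-cong; length-++; filter-≐)
open import Data.List.Relation.Binary.Permutation.Propositional using (_↭_; ↭-refl; ↭-prep; ↭-swap; ↭-trans; ↭⇒↭ₛ)
open import Data.List.Relation.Binary.Permutation.Propositional.Properties using (map⁺; ↭-length; All-resp-↭)
import Data.List.Relation.Binary.Permutation.Setoid.Properties as PermS
open import Data.List.Relation.Unary.All as All using (All; []; _∷_)
open import Data.List.Relation.Unary.AllPairs as AllPairs using ([]; _∷_)
open import Data.List.Relation.Unary.Any as Any using (here; there)
open import Data.List.Relation.Unary.Any.Properties using (lookup-index)
open import Data.List.Relation.Unary.Unique.DecPropositional.Properties using (deduplicate-!)
open import Data.List.Relation.Unary.Unique.Propositional using (Unique)
import Data.List.Relation.Unary.Unique.Propositional.Properties as UniqueP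
open import Data.Nat as ℕ using (ℕ; zero; suc; z≤n; s≤s)
import Data.Nat.DivMod as ℕD
open import Data.Nat.ListAction using (sum)
open import Data.Nat.ListAction.Properties using (sum-↭; sum-++)
import Data.Nat.Properties as ℕP
import Data.Nat.Tactic.RingSolver as ℕSolver
open import Data.Product using (∃; ∃₂; _×_; _,_; proj₁; proj₂)
open import Data.Sum as Sum using (_⊎_; inj₁; inj₂)
open import Function using (_∘_; id)
open import Level using (0ℓ)
open import Relation.Binary.Definitions using (Trichotomous; tri<; tri≈; tri>; DecidableEquality)
open import Relation.Binary.PropositionalEquality
import Relation.Binary.Reasoning.Setoid
open import Relation.Binary.Structures using (IsStrictTotalOrder)
open import Relation.Nullary using (¬_; Dec; yes; no; does; ¬?; contradiction)
open import Relation.Nullary.Decidable using (decidable-stable)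
open import Relation.Unary using (Decidable)

-- Optimising the peeling bounds

module _ where
  open I using (_+_; _*_; _-_; _≤_)

  0≤-* : ∀ {x y} → 0ℤ ≤ x → 0ℤ ≤ y → 0ℤ ≤ x * y
  0≤-* {+ a} {+ b} _ _ = subst (0ℤ ≤_) (ℤP.pos-* a b) (I.+≤+ ℕ.z≤n)

  0≤-sq : ∀ x → 0ℤ ≤ x * x
  0≤-sq (+ a)      = 0≤-* {+ a} {+ a} (I.+≤+ ℕ.z≤n) (I.+≤+ ℕ.z≤n)
  0≤-sq I.-[1+ a ] = I.+≤+ ℕ.z≤n

  0≤+ : ∀ n → 0ℤ ≤ + n
  0≤+ _ = I.+≤+ ℕ.z≤n

  slack : ∀ {x y} → x ≤ y → 0ℤ ≤ y - x
  slack = ℤP.i≤j⇒0≤j-i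

  ≤-from-slack : ∀ {x y e} → y - x ≡ e → 0ℤ ≤ e → x ≤ y
  ≤-from-slack eq p = ℤP.0≤i-j⇒j≤i (subst (0ℤ ≤_) (sym eq) p)

  ≤-from-slack₂ : ∀ {x y e} → + 2 * (y - x) ≡ e → 0ℤ ≤ e → x ≤ y
  ≤-from-slack₂ {x} {y} eq p = ℤP.0≤i-j⇒j≤i (ℤP.*-cancelˡ-≤-pos 0ℤ (y - x) (+ 2) (subst (0ℤ ≤_) (sym eq) p))

  -- Identities of this kind are certificates: the room left in the bound is a combination of the
  -- slacks of the hypotheses, products of nonnegative factors, and squares. Here the two full grids
  -- and `U` add up to (N² - (s - t)²)/4.
  no-peeling-identity : ∀ m n s t z T₁ T₀ X₁ X₂ → let N = + 2 * m + s + (+ 2 * n + t) in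
     (+ 3 * ((N + z) * (N + z)) + + 10 * (N + z)) - + 20 * (T₁ + T₀ + X₁ + X₂)
     ≡ + 5 * (z * z - + 4 * T₁) + + 20 * ((+ 2 * (m * n) + s * n + m * t + s * t) - T₀)
       + + 20 * (m * (m + s) - X₁) + + 20 * (n * (n + t) - X₂)
       + + 5 * ((s - t) * (s - t)) + + 10 * (N + z)
       + + 2 * ((+ 2 * z - N) * (N - z)) + + 2 * (z * z)
  no-peeling-identity = ℤSolver.solve-∀

  -- Inserting the inductive bound for `T₀` cancels the N² terms; apart from a linear term, what
  -- remains is `z` times the comparison of 10(m + n) + z with 3N.
  by-induction-identity : ∀ m n s t z T₁ T₀ X₁ X₂ → let N = + 2 * m + s + (+ 2 * n + t) in
     (+ 3 * ((N + z) * (N + z)) + + 10 * (N + z)) - + 20 * (T₁ + T₀ + X₁ + X₂)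
     ≡ + 5 * (z * z - + 4 * T₁) + ((+ 3 * (N * N) + + 10 * N) - + 20 * T₀)
       + + 20 * (m * z - X₁) + + 20 * (n * z - X₂)
       + + 2 * (z * (+ 3 * N - (+ 10 * (m + n) + z))) + + 10 * z
  by-induction-identity = ℤSolver.solve-∀

  -- The quadratic form in the last line has no evident sign; the next two identities treat it on
  -- either side of 2N = 9z.
  full-peeling-identity : ∀ m n s t z T₁ T₀ X₁ X₂ → let N = + 2 * m + s + (+ 2 * n + t) in
     + 2 * ((+ 3 * ((N + z) * (N + z)) + + 10 * (N + z)) - + 20 * (T₁ + T₀ + X₁ + X₂))
     ≡ + 10 * (z * z - + 4 * T₁) + + 40 * ((+ 2 * (m * n) + s * n + m * t + s * t) - T₀)
       + + 40 * (m * z - X₁) + + 40 * (n * z - X₂)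
       + + 5 * ((+ 2 * m + s - (+ 2 * n + t)) * (+ 2 * m + s - (+ 2 * n + t)))
       + + 5 * ((s - t) * (s - t)) + + 20 * (N + z)
       + ((s - z) + (t - z)) * (+ 10 * (m + n) + z - + 3 * N)
       + (N * N - + 4 * (N * z) - + 2 * (z * z) + + 9 * ((s + t) * z) - + 2 * (N * (s + t)))
  full-peeling-identity = ℤSolver.solve-∀

  full-peeling-small-N : ∀ m n s t z → let N = + 2 * m + s + (+ 2 * n + t) in
     N * N - + 4 * (N * z) - + 2 * (z * z) + + 9 * ((s + t) * z) - + 2 * (N * (s + t)) - 0ℤ
     ≡ (+ 9 * z - + 2 * N) * ((s - z) + (t - z)) + (N - + 4 * z) * (N - + 4 * z)
  full-peeling-small-N = ℤSolver.solve-∀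

  full-peeling-large-N : ∀ m n s t z → let N = + 2 * m + s + (+ 2 * n + t) ; g = + 2 * N - + 9 * z in
     + 20 * (N * N - + 4 * (N * z) - + 2 * (z * z) + + 9 * ((s + t) * z) - + 2 * (N * (s + t)) - 0ℤ)
     ≡ + 4 * (g * (+ 10 * (m + n) + z - + 3 * N)) + g * g + + 10 * (g * z) + + 5 * (z * z)
  full-peeling-large-N = ℤSolver.solve-∀

  -- The rounding allowances of the two gains cost 20 in total. They are paid from the doubled
  -- linear term 20(N + z), which leaves 20(N + z - 1).
  balanced-peeling-identity : ∀ m n s t z T₁ T₀ X₁ X₂ G₁ G₂ → let N = + 2 * m + s + (+ 2 * n + t) in
     + 2 * ((+ 3 * ((N + z) * (N + z)) + + 10 * (N + z)) - + 20 * (T₁ + T₀ + X₁ + X₂))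
     ≡ + 10 * (z * z - + 4 * T₁) + + 40 * ((+ 2 * (m * n) + s * n + m * t + s * t) - T₀)
       + + 10 * ((+ 4 * (m * (m + s)) - G₁ + 1ℤ) - + 4 * X₁) + + 10 * ((+ 4 * (n * (n + t)) - G₂ + 1ℤ) - + 4 * X₂)
       + (+ 6 * ((N + z) * (N + z)) + + 10 * ((s - t) * (s - t) + G₂) + + 10 * G₁ - (+ 10 * (N * N) + + 10 * (z * z)))
       + + 20 * (N + z - 1ℤ)
  balanced-peeling-identity = ℤSolver.solve-∀

  -- The two squares vanish together exactly when P = Q and N = 4z, the shape of the extremal
  -- configuration.
  gain-square-identity : ∀ P Q z R →
     (+ 6 * ((P + Q + z) * (P + Q + z)) + + 10 * R + + 10 * ((P - z) * (P - z))) - (+ 10 * ((P + Q) * (P + Q)) + + 10 * (z * z))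
     ≡ + 10 * (R - (Q - z) * (Q - z)) + (P + Q - + 4 * z) * (P + Q - + 4 * z) + + 5 * ((P - Q) * (P - Q))
  gain-square-identity = ℤSolver.solve-∀

  gain-zero-identity : ∀ P Q z R →
     (+ 6 * ((P + Q + z) * (P + Q + z)) + + 10 * R + + 10 * 0ℤ) - (+ 10 * ((P + Q) * (P + Q)) + + 10 * (z * z))
     ≡ + 10 * (R - (Q - z) * (Q - z)) + (P + Q - + 4 * z) * (P + Q - + 4 * z)
       + + 5 * ((P + Q - + 2 * z) * (P + Q - + 2 * z)) + + 20 * ((P + Q - + 2 * z) * (z - P)) + + 10 * ((z - P) * (z - P))
  gain-zero-identity = ℤSolver.solve-∀

  -- If s ≤ z ≤ t, peeling all `n` hooks falls short of the ideal gain (Q - z)² by (t - z)². The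
  -- term (s - t)², by which unequal gaps lower the total without peeling, makes up for it.
  gain-full-excess : ∀ s t z n → let Q = + 2 * n + t in
     ((s - t) * (s - t) + ((Q - z) * (Q - z) - (t - z) * (t - z))) - (Q - z) * (Q - z)
     ≡ (z - s) * (z - s) + + 2 * ((z - s) * (t - z))
  gain-full-excess = ℤSolver.solve-∀

  gain-full-identity : ∀ n t z X → let Q = + 2 * n + t in
     (+ 4 * (n * (n + t)) - ((Q - z) * (Q - z) - (t - z) * (t - z)) + 1ℤ) - + 4 * X
     ≡ + 4 * (n * z - X) + 1ℤ
  gain-full-identity = ℤSolver.solve-∀

  -- The choice of `z` says P - z = 2k + e, so `k` is the optimum (P - z)/2 rounded down, and e² is
  -- the price of the rounding.
  gain-half-identity : ∀ k j s e X → let m = k + j ; z = + 2 * j + s - e ; P = + 2 * m + s in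
     (+ 4 * (m * (m + s)) - (P - z) * (P - z) + 1ℤ) - + 4 * X
     ≡ + 4 * ((k * z + j * (j + s)) - X) + (1ℤ - e * e)
  gain-half-identity = ℤSolver.solve-∀

  ≤-+ˡ : ∀ {x} y → 0ℤ ≤ x → y ≤ x + y
  ≤-+ˡ {x} y p = subst (_≤ x + y) (ℤP.+-identityˡ y) (ℤP.+-monoˡ-≤ y p)

  infixl 6 _⊕_
  infixr 7 _⊛_

  _⊕_ : ∀ {x y} → 0ℤ ≤ x → 0ℤ ≤ y → 0ℤ ≤ x + y
  _⊕_ = ℤP.+-mono-≤

  _⊛_ : ∀ n {x} → 0ℤ ≤ x → 0ℤ ≤ + n * x
  n ⊛ p = 0≤-* (0≤+ n) p

  -- Peeling k hooks off an m × (m + s) grid saves k (2m + s - z - k); G is four times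
  -- the saving, and the 1 pays for rounding the optimal k = (2m + s - z) / 2.
  PeelingGain : ℤ → ℤ → ℤ → ℤ → Set
  PeelingGain m s X G = + 4 * X ≤ + 4 * (m * (m + s)) - G + 1ℤ

  -- The classes 0 and 2 mod 4 of A and B form grids of sizes m and m + s (with X₁
  -- solutions) and n and n + t (with X₂); T₁ and T₀ count the triples with a, b odd
  -- and with a, b, c even.
  module Cases (m n s t z T₁ T₀ X₁ X₂ : ℤ) where

    P = + 2 * m + s
    Q = + 2 * n + t
    N = P + Q
    U = + 2 * (m * n) + s * n + m * t + s * t

    TripleBound = + 20 * (T₁ + T₀ + X₁ + X₂) ≤ + 3 * ((N + z) * (N + z)) + + 10 * (N + z)

    no-peeling : 0ℤ ≤ z → z ≤ N → N ≤ + 2 * z →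
      + 4 * T₁ ≤ z * z → T₀ ≤ U → X₁ ≤ m * (m + s) → X₂ ≤ n * (n + t) → TripleBound
    no-peeling z≥0 z≤N N≤2z h₁ h₀ x₁ x₂ = ≤-from-slack (no-peeling-identity m n s t z T₁ T₀ X₁ X₂)
      (5 ⊛ slack h₁ ⊕ 20 ⊛ slack h₀ ⊕ 20 ⊛ slack x₁ ⊕ 20 ⊛ slack x₂ ⊕ 5 ⊛ 0≤-sq (s - t)
       ⊕ 10 ⊛ (ℤP.≤-trans z≥0 z≤N ⊕ z≥0) ⊕ 2 ⊛ 0≤-* (slack N≤2z) (slack z≤N) ⊕ 2 ⊛ 0≤-sq z)

    by-induction : 0ℤ ≤ z → + 10 * (m + n) + z ≤ + 3 * N →
      + 4 * T₁ ≤ z * z → + 20 * T₀ ≤ + 3 * (N * N) + + 10 * N → X₁ ≤ m * z → X₂ ≤ n * z → TripleBound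
    by-induction z≥0 few h₁ h₀ x₁ x₂ = ≤-from-slack (by-induction-identity m n s t z T₁ T₀ X₁ X₂)
      (5 ⊛ slack h₁ ⊕ slack h₀ ⊕ 20 ⊛ slack x₁ ⊕ 20 ⊛ slack x₂
       ⊕ 2 ⊛ 0≤-* z≥0 (slack few) ⊕ 10 ⊛ z≥0)

    full-peeling : 0ℤ ≤ z → 0ℤ ≤ N → z ≤ s → z ≤ t → + 3 * N ≤ + 10 * (m + n) + z →
      + 4 * T₁ ≤ z * z → T₀ ≤ U → X₁ ≤ m * z → X₂ ≤ n * z → TripleBound
    full-peeling z≥0 N≥0 z≤s z≤t many h₁ h₀ x₁ x₂ = ≤-from-slack₂ (full-peeling-identity m n s t z T₁ T₀ X₁ X₂)
      (10 ⊛ slack h₁ ⊕ 40 ⊛ slack h₀ ⊕ 40 ⊛ slack x₁ ⊕ 40 ⊛ slack x₂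
       ⊕ 5 ⊛ 0≤-sq (P - Q) ⊕ 5 ⊛ 0≤-sq (s - t) ⊕ 20 ⊛ (N≥0 ⊕ z≥0)
       ⊕ 0≤-* (slack z≤s ⊕ slack z≤t) (slack many) ⊕ rest)
      where
      V = N * N - + 4 * (N * z) - + 2 * (z * z) + + 9 * ((s + t) * z) - + 2 * (N * (s + t))
      rest : 0ℤ ≤ V
      -- In `V` the coefficient of s + t is 9z - 2N. If it is nonnegative, s + t ≥ 2z suffices;
      -- otherwise `many`, which amounts to 5(s + t) ≤ 2N + z, bounds s + t from above.
      rest with ℤP.≤-total (+ 2 * N) (+ 9 * z)
      ... | inj₁ le = ≤-from-slack (full-peeling-small-N m n s t z)
              (0≤-* (slack le) (slack z≤s ⊕ slack z≤t) ⊕ 0≤-sq (N - + 4 * z))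
      ... | inj₂ ge = ℤP.0≤i-j⇒j≤i {V} {0ℤ} (ℤP.*-cancelˡ-≤-pos 0ℤ (V - 0ℤ) (+ 20)
              (subst (0ℤ ≤_) (sym (full-peeling-large-N m n s t z))
                (4 ⊛ 0≤-* (slack ge) (slack many) ⊕ 0≤-sq (+ 2 * N - + 9 * z)
                 ⊕ 10 ⊛ 0≤-* (slack ge) z≥0 ⊕ 5 ⊛ 0≤-sq z)))

    balanced-peeling : ∀ {G₁ G₂} → 1ℤ ≤ N + z → + 2 * z ≤ N →
      G₁ ≡ (P - z) * (P - z) ⊎ (G₁ ≡ 0ℤ × P ≤ z) →
      (Q - z) * (Q - z) ≤ (s - t) * (s - t) + G₂ →
      + 4 * T₁ ≤ z * z → T₀ ≤ U → PeelingGain m s X₁ G₁ → PeelingGain n t X₂ G₂ → TripleBound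
    balanced-peeling {G₁} {G₂} N+z≥1 2z≤N g₁ g₂ h₁ h₀ x₁ x₂ =
      ≤-from-slack₂ (balanced-peeling-identity m n s t z T₁ T₀ X₁ X₂ G₁ G₂)
      (10 ⊛ slack h₁ ⊕ 40 ⊛ slack h₀ ⊕ 10 ⊛ slack x₁ ⊕ 10 ⊛ slack x₂ ⊕ rest g₁ ⊕ 20 ⊛ slack N+z≥1)
      where
      R = (s - t) * (s - t) + G₂
      rest : G₁ ≡ (P - z) * (P - z) ⊎ (G₁ ≡ 0ℤ × P ≤ z) →
        0ℤ ≤ + 6 * ((N + z) * (N + z)) + + 10 * R + + 10 * G₁ - (+ 10 * (N * N) + + 10 * (z * z))
      rest (inj₁ refl) = subst (0ℤ ≤_) (sym (gain-square-identity P Q z R))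
        (10 ⊛ slack g₂ ⊕ 0≤-sq (N - + 4 * z) ⊕ 5 ⊛ 0≤-sq (P - Q))
      rest (inj₂ (refl , P≤z)) = subst (0ℤ ≤_) (sym (gain-zero-identity P Q z R))
        (10 ⊛ slack g₂ ⊕ 0≤-sq (N - + 4 * z) ⊕ 5 ⊛ 0≤-sq (N - + 2 * z)
         ⊕ 20 ⊛ 0≤-* (slack 2z≤N) (slack P≤z) ⊕ 10 ⊛ 0≤-sq (z - P))

  swap-lhs : ∀ a b c d → + 20 * (a + b + d + c) ≡ + 20 * (a + b + c + d)
  swap-lhs = ℤSolver.solve-∀

  swap-rhs : ∀ p q z → + 3 * ((q + p + z) * (q + p + z)) + + 10 * (q + p + z) ≡ + 3 * ((p + q + z) * (p + q + z)) + + 10 * (p + q + z)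
  swap-rhs = ℤSolver.solve-∀

  swap-U : ∀ m n s t → + 2 * (m * n) + s * n + m * t + s * t ≡ + 2 * (n * m) + t * m + n * s + t * s
  swap-U = ℤSolver.solve-∀

-- The outcome of peeling an m × (m + s) grid: `k` hooks with at most `z` solutions each, and every
-- cell of the remaining j × (j + s) grid counted.
Hook : ℕ → ℕ → ℕ → ℕ → Set
Hook m s z X = ∀ k j → k ℕ.+ j ≡ m → X ℕ.≤ k ℕ.* z ℕ.+ j ℕ.* (j ℕ.+ s)

halve : ∀ d m → d ℕ.≤ 2 ℕ.* m → ∃₂ λ k j → ∃ λ e → k ℕ.+ j ≡ m × d ≡ e ℕ.+ 2 ℕ.* k × e ℕ.≤ 1
halve d m d≤2m = k , m ℕ.∸ k , d ℕD.% 2 , ℕP.m+[n∸m]≡n k≤m , eq , ℕ.s≤s⁻¹ (ℕD.m%n<n d 2)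
  where
  k = d ℕD./ 2
  eq : d ≡ d ℕD.% 2 ℕ.+ 2 ℕ.* k
  eq = trans (ℕD.m≡m%n+[m/n]*n d 2) (cong (d ℕD.% 2 ℕ.+_) (ℕP.*-comm k 2))
  k≤m : k ℕ.≤ m
  k≤m = ℕP.*-cancelˡ-≤ 2 (ℕP.≤-trans (ℕP.m≤n+m (2 ℕ.* k) (d ℕD.% 2)) (ℕP.≤-trans (ℕP.≤-reflexive (sym eq)) d≤2m))

module _ where
  open I using (_+_; _*_; _-_; _≤_)

  private variable m s z X : ℕ

  pos-P : ∀ m s → + (2 ℕ.* m ℕ.+ s) ≡ + 2 * + m + + s
  pos-P m s = cong (_+ + s) (ℤP.pos-* 2 m)

  hook-partial : Hook m s z X → ∀ k j → k ℕ.+ j ≡ m → + X ≤ + k * + z + + j * (+ j + + s)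
  hook-partial {s = s} {z} {X} h k j eq =
    subst (+ X ≤_) (cong₂ _+_ (ℤP.pos-* k z) (ℤP.pos-* j (j ℕ.+ s))) (I.+≤+ (h k j eq))

  hook-none : Hook m s z X → + X ≤ + m * (+ m + + s)
  hook-none {m} {s} {z} {X} h = subst (+ X ≤_) (ℤP.pos-* m (m ℕ.+ s)) (I.+≤+ (h 0 m refl))

  hook-full : Hook m s z X → + X ≤ + m * + z
  hook-full {m} {s} {z} {X} h = subst (+ X ≤_)
    (trans (cong +_ (ℕP.+-identityʳ (m ℕ.* z))) (ℤP.pos-* m z)) (I.+≤+ (h m 0 (ℕP.+-identityʳ m)))

  gain-none : Hook m s z X → PeelingGain (+ m) (+ s) (+ X) 0ℤ
  gain-none {m} {s} {X = X} h = ≤-from-slack (lemma (+ m) (+ s) (+ X)) (4 ⊛ slack (hook-none h) ⊕ 0≤+ 1)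
    where
    lemma : ∀ m s X → (+ 4 * (m * (m + s)) - 0ℤ + 1ℤ) - + 4 * X ≡ + 4 * (m * (m + s) - X) + 1ℤ
    lemma = ℤSolver.solve-∀

  -- The difference of squares is 4m(m + s - z), four times the saving from peeling all `m` hooks,
  -- so nothing is rounded.
  gain-full : Hook m s z X → let P = + 2 * + m + + s in
    PeelingGain (+ m) (+ s) (+ X) ((P - + z) * (P - + z) - (+ s - + z) * (+ s - + z))
  gain-full {m} {s} {z} {X} h = ≤-from-slack (gain-full-identity (+ m) (+ s) (+ z) (+ X)) (4 ⊛ slack (hook-full h) ⊕ 0≤+ 1)

  gain-half : Hook m s z X → s ℕ.≤ z → z ℕ.≤ 2 ℕ.* m ℕ.+ s → let P = + 2 * + m + + s in
    PeelingGain (+ m) (+ s) (+ X) ((P - + z) * (P - + z))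
  gain-half {m} {s} {z} {X} h s≤z z≤P
    with halve (2 ℕ.* m ℕ.+ s ℕ.∸ z) m
           (ℕP.≤-trans (ℕP.∸-monoʳ-≤ (2 ℕ.* m ℕ.+ s) s≤z) (ℕP.≤-reflexive (ℕP.m+n∸n≡m (2 ℕ.* m) s)))
  ... | k , j , e , refl , d≡ , e≤1 =
    subst (λ z → PeelingGain (+ k + + j) (+ s) (+ X) ((P - z) * (P - z))) (sym z≡)
      (≤-from-slack (gain-half-identity (+ k) (+ j) (+ s) (+ e) (+ X))
        (4 ⊛ slack (subst (λ z → + X ≤ + k * z + + j * (+ j + + s)) z≡ (hook-partial h k j refl)) ⊕ 1-e² e e≤1))
    where
    P = + 2 * (+ k + + j) + + s
    1-e² : ∀ e → e ℕ.≤ 1 → 0ℤ ≤ 1ℤ - + e * + e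
    1-e² 0 _ = 0≤+ 1
    1-e² 1 _ = 0≤+ 0
    1-e² (suc (suc _)) (ℕ.s≤s ())
    sum≡ : + e + + 2 * + k + + z ≡ + 2 * (+ k + + j) + + s
    sum≡ = begin
      + e + + 2 * + k + + z                       ≡⟨ cong (λ x → + e + x + + z) (ℤP.pos-* 2 k) ⟨
      + (e ℕ.+ 2 ℕ.* k ℕ.+ z)                     ≡⟨ cong (λ x → + (x ℕ.+ z)) d≡ ⟨
      + (2 ℕ.* (k ℕ.+ j) ℕ.+ s ℕ.∸ z ℕ.+ z)       ≡⟨ cong +_ (ℕP.m∸n+n≡m z≤P) ⟩
      + (2 ℕ.* (k ℕ.+ j) ℕ.+ s)                   ≡⟨ pos-P (k ℕ.+ j) s ⟩
      + 2 * (+ k + + j) + + s                     ∎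
      where open ≡-Reasoning
    isolate : ∀ e k j s z → z ≡ (e + + 2 * k + z) - (+ 2 * (k + j) + s) + (+ 2 * j + s - e)
    isolate = ℤSolver.solve-∀
    z≡ : + z ≡ + 2 * + j + + s - + e
    z≡ = begin
      + z
        ≡⟨ isolate (+ e) (+ k) (+ j) (+ s) (+ z) ⟩
      (+ e + + 2 * + k + + z) - (+ 2 * (+ k + + j) + + s) + (+ 2 * + j + + s - + e)
        ≡⟨ cong (_+ (+ 2 * + j + + s - + e)) (ℤP.i≡j⇒i-j≡0 sum≡) ⟩
      0ℤ + (+ 2 * + j + + s - + e)
        ≡⟨ ℤP.+-identityˡ _ ⟩
      + 2 * + j + + s - + e ∎
      where open ≡-Reasoning

module _ (m n s t z T₁ T₀ X₁ X₂ : ℕ) where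
  open I using (_+_; _*_; _-_; _≤_)
  open Cases (+ m) (+ n) (+ s) (+ t) (+ z) (+ T₁) (+ T₀) (+ X₁) (+ X₂)

  -- Since s ≤ z, the optimum (P - z)/2 is at most `m`, so it can be realised on the first grid up
  -- to rounding; if it is negative, nothing is peeled there.
  one-side-short : 1 ℕ.≤ z → + 2 * + z ≤ N → s ℕ.≤ z → z ℕ.≤ 2 ℕ.* n ℕ.+ t →
    + 4 * + T₁ ≤ + z * + z → + T₀ ≤ U → Hook m s z X₁ → Hook n t z X₂ → TripleBound
  one-side-short 1≤z 2z≤N s≤z z≤Q h₁ h₀ x₁ x₂ =
    let _ , g₁ , x₁′ = gain₁
        _ , g₂ , x₂′ = gain₂
    in balanced-peeling 1≤N+z 2z≤N g₁ g₂ h₁ h₀ x₁′ x₂′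
    where
    1≤N+z : 1ℤ ≤ N + + z
    1≤N+z = ℤP.+-mono-≤ (ℤP.≤-trans (2 ⊛ 0≤+ z) 2z≤N) (I.+≤+ 1≤z)
    gain₁ : ∃ λ G → (G ≡ (P - + z) * (P - + z) ⊎ (G ≡ 0ℤ × P ≤ + z)) × PeelingGain (+ m) (+ s) (+ X₁) G
    gain₁ with ℕP.≤-total z (2 ℕ.* m ℕ.+ s)
    ... | inj₁ z≤P = _ , inj₁ refl , gain-half x₁ s≤z z≤P
    ... | inj₂ P≤z = _ , inj₂ (refl , subst (_≤ + z) (pos-P m s) (I.+≤+ P≤z)) , gain-none x₁
    gain₂ : ∃ λ G → ((Q - + z) * (Q - + z) ≤ (+ s - + t) * (+ s - + t) + G) × PeelingGain (+ n) (+ t) (+ X₂) G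
    gain₂ with ℕP.≤-total z t
    -- Here the optimum (Q - z)/2 is at least `n`, so the whole second grid is peeled.
    ... | inj₁ z≤t = _ , ≤-from-slack (gain-full-excess (+ s) (+ t) (+ z) (+ n))
                           (0≤-sq (+ z - + s) ⊕ 2 ⊛ 0≤-* (slack (I.+≤+ s≤z)) (slack (I.+≤+ z≤t)))
                       , gain-full x₂
    ... | inj₂ t≤z = _ , ≤-+ˡ ((Q - + z) * (Q - + z)) (0≤-sq (+ s - + t)) , gain-half x₂ t≤z z≤Q

module _ (m n s t z T₁ T₀ X₁ X₂ : ℕ) where
  open I using (_+_; _*_; _-_; _≤_)
  open Cases (+ m) (+ n) (+ s) (+ t) (+ z) (+ T₁) (+ T₀) (+ X₁) (+ X₂)

  other-side-short : 1 ℕ.≤ z → + 2 * + z ≤ N → t ℕ.≤ z → z ℕ.≤ 2 ℕ.* m ℕ.+ s →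
    + 4 * + T₁ ≤ + z * + z → + T₀ ≤ U → Hook m s z X₁ → Hook n t z X₂ → TripleBound
  other-side-short 1≤z 2z≤N t≤z z≤P h₁ h₀ x₁ x₂ =
    subst₂ _≤_ (swap-lhs (+ T₁) (+ T₀) (+ X₁) (+ X₂)) (swap-rhs P Q (+ z))
      (one-side-short n m t s z T₁ T₀ X₂ X₁ 1≤z (subst (+ 2 * + z ≤_) (ℤP.+-comm P Q) 2z≤N) t≤z z≤P
        h₁ (subst (+ T₀ ≤_) (swap-U (+ m) (+ n) (+ s) (+ t)) h₀) x₂ x₁)

  peeling-boundℤ : 1 ℕ.≤ z → + z ≤ N → + 4 * + T₁ ≤ + z * + z →
    + T₀ ≤ U → + 20 * + T₀ ≤ + 3 * (N * N) + + 10 * N →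
    Hook m s z X₁ → Hook n t z X₂ → TripleBound
  peeling-boundℤ 1≤z z≤N h₁ h₀ ih x₁ x₂ with ℤP.≤-total N (+ 2 * + z)
  ... | inj₁ N≤2z = no-peeling (0≤+ z) z≤N N≤2z h₁ h₀ (hook-none x₁) (hook-none x₂)
  ... | inj₂ 2z≤N with ℤP.≤-total (+ 10 * (+ m + + n) + + z) (+ 3 * N)
  ...   | inj₁ few = by-induction (0≤+ z) few h₁ ih (hook-full x₁) (hook-full x₂)
  ...   | inj₂ many with ℕP.≤-total s z | ℕP.≤-total t z
  ...     | inj₂ z≤s | inj₂ z≤t =
    full-peeling (0≤+ z) (ℤP.≤-trans (0≤+ z) z≤N) (I.+≤+ z≤s) (I.+≤+ z≤t) many h₁ h₀ (hook-full x₁) (hook-full x₂)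
  ...     | inj₁ s≤z | inj₂ z≤t =
    one-side-short m n s t z T₁ T₀ X₁ X₂ 1≤z 2z≤N s≤z (ℕP.≤-trans z≤t (ℕP.m≤n+m t _)) h₁ h₀ x₁ x₂
  ...     | inj₂ z≤s | inj₁ t≤z =
    other-side-short 1≤z 2z≤N t≤z (ℕP.≤-trans z≤s (ℕP.m≤n+m s _)) h₁ h₀ x₁ x₂
  ...     | inj₁ s≤z | inj₁ t≤z with ℕP.≤-total z (2 ℕ.* n ℕ.+ t)
  ...       | inj₁ z≤Q = one-side-short m n s t z T₁ T₀ X₁ X₂ 1≤z 2z≤N s≤z z≤Q h₁ h₀ x₁ x₂
  -- As P + Q = N ≥ 2z, the two sides cannot both lie below `z`.
  ...       | inj₂ Q≤z = other-side-short 1≤z 2z≤N t≤z (I.drop‿+≤+ z≤P) h₁ h₀ x₁ x₂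
    where
    lemma : ∀ P Q z → P - z ≡ (P + Q - + 2 * z) + (z - Q)
    lemma = ℤSolver.solve-∀
    z≤P : + z ≤ + (2 ℕ.* m ℕ.+ s)
    z≤P = subst (+ z ≤_) (sym (pos-P m s)) (≤-from-slack (lemma P Q (+ z))
      (slack 2z≤N ⊕ slack (subst (_≤ + z) (pos-P n t) (I.+≤+ Q≤z))))

  peeling-bound : let N = 2 ℕ.* m ℕ.+ s ℕ.+ (2 ℕ.* n ℕ.+ t) in
    1 ℕ.≤ z → z ℕ.≤ N → 4 ℕ.* T₁ ℕ.≤ z ℕ.* z →
    T₀ ℕ.≤ 2 ℕ.* (m ℕ.* n) ℕ.+ s ℕ.* n ℕ.+ m ℕ.* t ℕ.+ s ℕ.* t →
    20 ℕ.* T₀ ℕ.≤ 3 ℕ.* (N ℕ.* N) ℕ.+ 10 ℕ.* N →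
    Hook m s z X₁ → Hook n t z X₂ →
    20 ℕ.* (T₁ ℕ.+ T₀ ℕ.+ X₁ ℕ.+ X₂) ℕ.≤ 3 ℕ.* ((N ℕ.+ z) ℕ.* (N ℕ.+ z)) ℕ.+ 10 ℕ.* (N ℕ.+ z)
  peeling-bound 1≤z z≤N h₁ h₀ ih x₁ x₂ = I.drop‿+≤+
    (subst₂ _≤_ (sym (ℤP.pos-* 20 (T₁ ℕ.+ T₀ ℕ.+ X₁ ℕ.+ X₂)))
      (trans (cong (λ x → + 3 * ((x + + z) * (x + + z)) + + 10 * (x + + z)) (sym N≡)) (sym (pos-bound (Nℕ ℕ.+ z))))
      (peeling-boundℤ 1≤z (subst (+ z ≤_) N≡ (I.+≤+ z≤N))
        (subst₂ _≤_ (ℤP.pos-* 4 T₁) (ℤP.pos-* z z) (I.+≤+ h₁))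
        (subst (+ T₀ ≤_) U≡ (I.+≤+ h₀))
        (subst₂ _≤_ (ℤP.pos-* 20 T₀)
          (trans (pos-bound Nℕ) (cong (λ x → + 3 * (x * x) + + 10 * x) N≡)) (I.+≤+ ih))
        x₁ x₂))
    where
    Nℕ = 2 ℕ.* m ℕ.+ s ℕ.+ (2 ℕ.* n ℕ.+ t)
    N≡ : + (2 ℕ.* m ℕ.+ s ℕ.+ (2 ℕ.* n ℕ.+ t)) ≡ N
    N≡ = cong₂ _+_ (pos-P m s) (pos-P n t)
    U≡ : + (2 ℕ.* (m ℕ.* n) ℕ.+ s ℕ.* n ℕ.+ m ℕ.* t ℕ.+ s ℕ.* t) ≡ U
    U≡ = cong₂ _+_ (cong₂ _+_ (cong₂ _+_ (trans (ℤP.pos-* 2 (m ℕ.* n)) (cong (+ 2 *_) (ℤP.pos-* m n)))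
           (ℤP.pos-* s n)) (ℤP.pos-* m t)) (ℤP.pos-* s t)
    pos-bound : ∀ x → + (3 ℕ.* (x ℕ.* x) ℕ.+ 10 ℕ.* x) ≡ + 3 * (+ x * + x) + + 10 * + x
    pos-bound x = cong₂ _+_ (trans (ℤP.pos-* 3 (x ℕ.* x)) (cong (+ 3 *_) (ℤP.pos-* x x))) (ℤP.pos-* 10 x)

-- Integer labellings preserving midpoints

δ : ∀ {n} → Fin n → Fin n → ℤ
δ zero    zero    = 1ℤ
δ zero    (suc _) = 0ℤ
δ (suc _) zero    = 0ℤ
δ (suc i) (suc j) = δ i j

-- xᵢ + xⱼ - 2xₖ, nested so that dot-combine applies.
midpointForm : ∀ {n} → Fin n → Fin n → Fin n → Fin n → ℤ
midpointForm i j k t = 1ℤ I.* (1ℤ I.* δ i t I.+ 1ℤ I.* δ j t) I.+ (I.- + 2) I.* δ k t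

-- Linear forms with integer coefficients

module _ (R : CommutativeRing 0ℓ 0ℓ) where
  open CommutativeRing R hiding (zero) renaming (refl to ≈-refl; sym to ≈-sym; trans to ≈-trans; setoid to ≈-setoid)
  open SemiringSolver commutativeSemiring using (solve; _:=_; _:+_; _:*_; con)

  -- The same forms are evaluated at real points and at integer points, so the target ring and the
  -- map `ι` into it are parameters.
  module LinearForms (ι : ℤ → Carrier) (ι-0 : ι 0ℤ ≈ 0#) (ι-1 : ι 1ℤ ≈ 1#)
    (ι-homo : ∀ c x d y → ι (c I.* x I.+ d I.* y) ≈ ι c * ι x + ι d * ι y) where

    dot : ∀ {n} → (Fin n → ℤ) → (Fin n → Carrier) → Carrier
    dot {zero}  e v = 0#
    dot {suc n} e v = ι (e zero) * v zero + dot (e ∘ suc) (v ∘ suc)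

    dot-combine : ∀ {n} c d (e f : Fin n → ℤ) v →
      dot (λ i → c I.* e i I.+ d I.* f i) v ≈ ι c * dot e v + ι d * dot f v
    dot-combine {zero} c d e f v =
      solve 2 (λ c d → con 0 := c :* con 0 :+ d :* con 0) ≈-refl (ι c) (ι d)
    dot-combine {suc n} c d e f v =
      ≈-trans (+-cong (*-congʳ (ι-homo c (e zero) d (f zero))) (dot-combine c d (e ∘ suc) (f ∘ suc) (v ∘ suc)))
        (solve 7 (λ c d x y v E F → (c :* x :+ d :* y) :* v :+ (c :* E :+ d :* F) := c :* (x :* v :+ E) :+ d :* (y :* v :+ F)) ≈-refl
          (ι c) (ι d) (ι (e zero)) (ι (f zero)) (v zero) (dot (e ∘ suc) (v ∘ suc)) (dot (f ∘ suc) (v ∘ suc)))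

    dot-zeroʳ : ∀ {n} (e : Fin n → ℤ) v → (∀ i → v i ≈ 0#) → dot e v ≈ 0#
    dot-zeroʳ {zero}  e v h = ≈-refl
    dot-zeroʳ {suc n} e v h =
      ≈-trans (+-cong (≈-trans (*-congˡ (h zero)) (zeroʳ _)) (dot-zeroʳ (e ∘ suc) (v ∘ suc) (h ∘ suc))) (+-identityˡ 0#)

    dot-zeroˡ : ∀ {n} (v : Fin n → Carrier) → dot (λ _ → 0ℤ) v ≈ 0#
    dot-zeroˡ {zero}  v = ≈-refl
    dot-zeroˡ {suc n} v = ≈-trans (+-cong (≈-trans (*-congʳ ι-0) (zeroˡ _)) (dot-zeroˡ (v ∘ suc))) (+-identityˡ 0#)

    dot-scale : ∀ {n} (e : Fin n → ℤ) x v → dot e (λ i → x * v i) ≈ x * dot e v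
    dot-scale {zero}  e x v = ≈-sym (zeroʳ x)
    dot-scale {suc n} e x v = ≈-trans (+-congˡ (dot-scale (e ∘ suc) x (v ∘ suc)))
      (solve 4 (λ e x v d → e :* (x :* v) :+ x :* d := x :* (e :* v :+ d)) ≈-refl
        (ι (e zero)) x (v zero) (dot (e ∘ suc) (v ∘ suc)))

    dot-δ : ∀ {n} (i : Fin n) v → dot (δ i) v ≈ v i
    dot-δ zero    v = ≈-trans (+-cong (≈-trans (*-congʳ ι-1) (*-identityˡ _)) (dot-zeroˡ (v ∘ suc))) (+-identityʳ _)
    dot-δ (suc i) v = ≈-trans (+-cong (≈-trans (*-congʳ ι-0) (zeroˡ _)) (dot-δ i (v ∘ suc))) (+-identityˡ _)

    dot-midpoint : ∀ {n} (i j k : Fin n) v → dot (midpointForm i j k) v ≈ v i + v j + ι (I.- + 2) * v k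
    dot-midpoint i j k v = begin
      dot (midpointForm i j k) v
        ≈⟨ dot-combine 1ℤ (I.- + 2) (λ t → 1ℤ I.* δ i t I.+ 1ℤ I.* δ j t) (δ k) v ⟩
      ι 1ℤ * dot (λ t → 1ℤ I.* δ i t I.+ 1ℤ I.* δ j t) v + ι (I.- + 2) * dot (δ k) v
        ≈⟨ +-cong (≈-trans (*-congʳ ι-1) (*-identityˡ _)) (*-congˡ (dot-δ k v)) ⟩
      dot (λ t → 1ℤ I.* δ i t I.+ 1ℤ I.* δ j t) v + ι (I.- + 2) * v k
        ≈⟨ +-congʳ (≈-trans (dot-combine 1ℤ 1ℤ (δ i) (δ j) v) (+-cong (unit i) (unit j))) ⟩
      v i + v j + ι (I.- + 2) * v k ∎
      where
      open Relation.Binary.Reasoning.Setoid ≈-setoid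
      unit : ∀ i → ι 1ℤ * dot (δ i) v ≈ v i
      unit i = ≈-trans (*-cong ι-1 (dot-δ i v)) (*-identityˡ _)

module ℤForms = LinearForms ℤP.+-*-commutativeRing id refl refl (λ _ _ _ _ → refl)

-- Parity and halving of integers

bit : ℤ → Bool
bit x with x I.%ℕ 2
... | zero  = false
... | suc _ = true

half : ℤ → ℤ
half x = x I./ℕ 2

⟦_⟧ : Bool → ℤ
⟦ false ⟧ = 0ℤ
⟦ true ⟧  = 1ℤ

bit-half : ∀ x → x ≡ ⟦ bit x ⟧ I.+ half x I.* + 2
bit-half x with x I.%ℕ 2 | ℤD.a≡a%ℕn+[a/ℕn]*n x 2 | ℤD.n%ℕd<d x 2
... | 0           | eq | _ = eq
... | 1           | eq | _ = eq
... | suc (suc _) | _  | s≤s (s≤s ())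

-- The equation is read modulo 2: b + b′ - c is even, but it would be 1 or -1 in every case that
-- violates the conclusion.
parity-xor : ∀ b b′ c k l → ⟦ b ⟧ I.+ ⟦ b′ ⟧ I.+ k I.* + 2 ≡ ⟦ c ⟧ I.+ l I.* + 2 → b xor b′ ≡ c
parity-xor b b′ c k l eq = cases b b′ c (trans (rearrange ⟦ b ⟧ ⟦ b′ ⟧ ⟦ c ⟧ k l)
    (trans (cong (λ x → x I.- k I.* + 2 I.- ⟦ c ⟧) (sym eq)) (cancel ⟦ b ⟧ ⟦ b′ ⟧ ⟦ c ⟧ k)))
  where
  rearrange : ∀ b b′ c k l → (l I.- k) I.* + 2 ≡ c I.+ l I.* + 2 I.- k I.* + 2 I.- c
  rearrange = ℤSolver.solve-∀
  cancel : ∀ b b′ c k → b I.+ b′ I.+ k I.* + 2 I.- k I.* + 2 I.- c ≡ b I.+ b′ I.- c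
  cancel = ℤSolver.solve-∀
  ∣even∣≢1 : ∀ x → I.∣ x I.* + 2 ∣ ≢ 1
  ∣even∣≢1 x eq with I.∣ x ∣ | trans (sym (ℤP.abs-* x (+ 2))) eq
  ... | zero  | ()
  ... | suc _ | ()
  cases : ∀ b b′ c → (l I.- k) I.* + 2 ≡ ⟦ b ⟧ I.+ ⟦ b′ ⟧ I.- ⟦ c ⟧ → b xor b′ ≡ c
  cases false false false _ = refl
  cases false false true  h = contradiction (cong I.∣_∣ h) (∣even∣≢1 (l I.- k))
  cases false true  false h = contradiction (cong I.∣_∣ h) (∣even∣≢1 (l I.- k))
  cases false true  true  _ = refl
  cases true  false false h = contradiction (cong I.∣_∣ h) (∣even∣≢1 (l I.- k))
  cases true  false true  _ = refl
  cases true  true  false _ = refl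
  cases true  true  true  h = contradiction (cong I.∣_∣ h) (∣even∣≢1 (l I.- k))

carry : ∀ a b h k → a I.+ b I.+ (h I.+ k) I.* + 2 ≡ (a I.+ h I.* + 2) I.+ (b I.+ k I.* + 2)
carry = ℤSolver.solve-∀

double : ∀ x → x I.+ x ≡ x I.* + 2
double = ℤSolver.solve-∀

bit-even : ∀ x → bit x ≡ false → x ≡ half x I.* + 2
bit-even x ¬odd = trans (bit-half x) (trans (cong (λ b → ⟦ b ⟧ I.+ half x I.* + 2) ¬odd) (ℤP.+-identityˡ _))

half-smaller : ∀ x → bit x ≡ false → half x ≢ 0ℤ → I.∣ half x ∣ ℕ.< I.∣ x ∣
half-smaller x ¬odd half≢0 = subst (I.∣ half x ∣ ℕ.<_) (sym ∣x∣≡)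
  (ℕP.m<m*n I.∣ half x ∣ 2 {{ℕ.≢-nonZero (half≢0 ∘ ℤP.∣i∣≡0⇒i≡0)}} (s≤s (s≤s z≤n)))
  where
  ∣x∣≡ : I.∣ x ∣ ≡ I.∣ half x ∣ ℕ.* 2
  ∣x∣≡ = trans (cong I.∣_∣ (bit-even x ¬odd)) (ℤP.abs-* (half x) (+ 2))

bit-suc : ∀ x → bit (x I.+ 1ℤ) ≡ not (bit x)
bit-suc x = trans (sym (parity-xor (bit x) true (bit (x I.+ 1ℤ)) (half x) (half (x I.+ 1ℤ))
    (trans (rearrange ⟦ bit x ⟧ (half x)) (trans (cong (I._+ 1ℤ) (sym (bit-half x))) (bit-half (x I.+ 1ℤ))))))
  (xor-true (bit x))
  where
  rearrange : ∀ b h → b I.+ 1ℤ I.+ h I.* + 2 ≡ b I.+ h I.* + 2 I.+ 1ℤ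
  rearrange = ℤSolver.solve-∀
  xor-true : ∀ b → b xor true ≡ not b
  xor-true true  = refl
  xor-true false = refl

module _ (x y z : ℤ) (x+y≡2z : x I.+ y ≡ z I.+ z) where

  midpoint-parity : bit x ≡ bit y
  midpoint-parity = xor-false (bit x) (bit y) (parity-xor (bit x) (bit y) false (half x I.+ half y) z (begin
    ⟦ bit x ⟧ I.+ ⟦ bit y ⟧ I.+ (half x I.+ half y) I.* + 2
      ≡⟨ carry ⟦ bit x ⟧ ⟦ bit y ⟧ (half x) (half y) ⟩
    (⟦ bit x ⟧ I.+ half x I.* + 2) I.+ (⟦ bit y ⟧ I.+ half y I.* + 2)
      ≡⟨ cong₂ I._+_ (bit-half x) (bit-half y) ⟨
    x I.+ y
      ≡⟨ trans x+y≡2z (double z) ⟩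
    z I.* + 2
      ≡⟨ ℤP.+-identityˡ _ ⟨
    0ℤ I.+ z I.* + 2 ∎))
    where
    open ≡-Reasoning
    xor-false : ∀ b b′ → b xor b′ ≡ false → b ≡ b′
    xor-false false false _ = refl
    xor-false true  true  _ = refl

  midpoint-half : bit x ≡ false → bit y ≡ false → half x I.+ half y ≡ z
  midpoint-half ex ey = ℤP.*-cancelʳ-≡ (half x I.+ half y) z (+ 2) (begin
    (half x I.+ half y) I.* + 2            ≡⟨ ℤP.*-distribʳ-+ (+ 2) (half x) (half y) ⟩
    half x I.* + 2 I.+ half y I.* + 2      ≡⟨ cong₂ I._+_ (bit-even x ex) (bit-even y ey) ⟨
    x I.+ y                                ≡⟨ trans x+y≡2z (double z) ⟩
    z I.* + 2                              ∎)
    where open ≡-Reasoning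

  -- Halving the relation gives half x + half y = z, and parities add. Thus even `x` and `y` agree
  -- mod 4 exactly when `z` is even.
  midpoint-second-bit : bit x ≡ false → bit y ≡ false → bit (half x) xor bit (half y) ≡ bit z
  midpoint-second-bit ex ey = parity-xor (bit (half x)) (bit (half y)) (bit z) (half (half x) I.+ half (half y)) (half z) (begin
    ⟦ bit (half x) ⟧ I.+ ⟦ bit (half y) ⟧ I.+ (half (half x) I.+ half (half y)) I.* + 2
      ≡⟨ carry ⟦ bit (half x) ⟧ ⟦ bit (half y) ⟧ (half (half x)) (half (half y)) ⟩
    (⟦ bit (half x) ⟧ I.+ half (half x) I.* + 2) I.+ (⟦ bit (half y) ⟧ I.+ half (half y) I.* + 2)
      ≡⟨ cong₂ I._+_ (bit-half (half x)) (bit-half (half y)) ⟨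
    half x I.+ half y
      ≡⟨ trans (midpoint-half ex ey) (bit-half z) ⟩
    ⟦ bit z ⟧ I.+ half z I.* + 2 ∎)
    where open ≡-Reasoning

-- The integers inside a model of the reals

module Labelling (ℝ : RealField) where
  open RealField ℝ
  open IsStrictTotalOrder isStrictTotalOrder using (compare; irrefl; asym) renaming (trans to <-trans)

  commutativeRing : CommutativeRing 0ℓ 0ℓ
  commutativeRing = record { isCommutativeRing = isCommutativeRing }

  open CommutativeRing commutativeRing using (ring; semiring; +-identityˡ; +-identityʳ; *-identityˡ; zeroˡ; zeroʳ; distribʳ; *-assoc; *-comm; -‿inverseʳ; +-comm; commutativeSemiring; +-commutativeSemigroup)
  open import Algebra.Properties.Semiring.Mult semiring using (×-homo-+) renaming (_×_ to _·_)
  open Algebra.Properties.Ring ring using (-0#≈0#; -‿+-comm; -‿involutive; -‿distribˡ-*; -1*x≈-x; x∙y⁻¹≈ε⇒x≈y)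
  open Algebra.Properties.CommutativeSemigroup +-commutativeSemigroup using (interchange)

  ι : ℤ → Carrier
  ι (+ n)    = n · 1#
  ι -[1+ n ] = - (suc n · 1#)

  ι-neg : ∀ x → ι (I.- x) ≡ - ι x
  ι-neg (+ zero)  = sym -0#≈0#
  ι-neg (+ suc n) = refl
  ι-neg -[1+ n ]  = sym (-‿involutive _)

  ι-⊖ : ∀ m n → ι (m ⊖ n) ≡ m · 1# + - (n · 1#)
  ι-⊖ m zero = sym (trans (cong (λ x → m · 1# + x) -0#≈0#) (+-identityʳ _))
  ι-⊖ zero (suc n) = sym (+-identityˡ _)
  ι-⊖ (suc m) (suc n) = begin
    ι (suc m ⊖ suc n)                      ≡⟨ cong ι (ℤP.[1+m]⊖[1+n]≡m⊖n m n) ⟩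
    ι (m ⊖ n)                              ≡⟨ ι-⊖ m n ⟩
    m · 1# + - (n · 1#)                    ≡⟨ +-identityˡ _ ⟨
    0# + (m · 1# + - (n · 1#))             ≡⟨ cong (_+ (m · 1# + - (n · 1#))) (-‿inverseʳ 1#) ⟨
    1# + - 1# + (m · 1# + - (n · 1#))      ≡⟨ interchange 1# (- 1#) (m · 1#) (- (n · 1#)) ⟩
    1# + m · 1# + (- 1# + - (n · 1#))      ≡⟨ cong (λ x → 1# + m · 1# + x) (-‿+-comm 1# (n · 1#)) ⟩
    1# + m · 1# + - (1# + n · 1#)          ∎
    where open ≡-Reasoning

  ι-+ : ∀ x y → ι (x I.+ y) ≡ ι x + ι y
  ι-+ (+ m)    (+ n)    = ×-homo-+ 1# m n
  ι-+ (+ m)    -[1+ n ] = ι-⊖ m (suc n)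
  ι-+ -[1+ m ] (+ n)    = trans (ι-⊖ n (suc m)) (+-comm _ _)
  ι-+ -[1+ m ] -[1+ n ] = begin
    - (suc (suc (m ℕ.+ n)) · 1#)         ≡⟨ cong (λ k → - (suc k · 1#)) (ℕP.+-suc m n) ⟨
    - ((suc m ℕ.+ suc n) · 1#)           ≡⟨ cong -_ (×-homo-+ 1# (suc m) (suc n)) ⟩
    - (suc m · 1# + suc n · 1#)          ≡⟨ -‿+-comm _ _ ⟨
    - (suc m · 1#) + - (suc n · 1#)      ∎
    where open ≡-Reasoning

  ι-*⁺ : ∀ m y → ι (+ m I.* y) ≡ ι (+ m) * ι y
  ι-*⁺ zero y = sym (zeroˡ (ι y))
  ι-*⁺ (suc m) y = begin
    ι (+ suc m I.* y)         ≡⟨ cong ι (ℤP.suc-* (+ m) y) ⟩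
    ι (y I.+ + m I.* y)       ≡⟨ ι-+ y (+ m I.* y) ⟩
    ι y + ι (+ m I.* y)       ≡⟨ cong₂ _+_ (sym (*-identityˡ (ι y))) (ι-*⁺ m y) ⟩
    1# * ι y + m · 1# * ι y   ≡⟨ distribʳ (ι y) 1# (m · 1#) ⟨
    (1# + m · 1#) * ι y       ∎
    where open ≡-Reasoning

  ι-* : ∀ x y → ι (x I.* y) ≡ ι x * ι y
  ι-* (+ m)    y = ι-*⁺ m y
  ι-* -[1+ m ] y = begin
    ι (-[1+ m ] I.* y)        ≡⟨ cong ι (ℤP.neg-distribˡ-* (+ suc m) y) ⟨
    ι (I.- (+ suc m I.* y))   ≡⟨ ι-neg (+ suc m I.* y) ⟩
    - ι (+ suc m I.* y)       ≡⟨ cong -_ (ι-*⁺ (suc m) y) ⟩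
    - (suc m · 1# * ι y)      ≡⟨ -‿distribˡ-* (suc m · 1#) (ι y) ⟩
    - (suc m · 1#) * ι y      ∎
    where open ≡-Reasoning

  ι-homo : ∀ c x d y → ι (c I.* x I.+ d I.* y) ≡ ι c * ι x + ι d * ι y
  ι-homo c x d y = trans (ι-+ (c I.* x) (d I.* y)) (cong₂ _+_ (ι-* c x) (ι-* d y))

  0<1 : 0# < 1#
  0<1 with compare 0# 1#
  ... | tri< 0<1 _ _ = 0<1
  ... | tri≈ _ 0≡1 _ = contradiction 0≡1 0≢1
  ... | tri> _ _ 1<0 = contradiction (subst (0# <_) (trans (-1*x≈-x (- 1#)) (-‿involutive 1#)) (*-pos 0<-1 0<-1)) (asym 1<0)
    where
    0<-1 : 0# < - 1#
    0<-1 = subst₂ _<_ (-‿inverseʳ 1#) (+-identityˡ (- 1#)) (+-mono-< (- 1#) 1<0)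

  0<suc· : ∀ n → 0# < suc n · 1#
  0<suc· zero    = subst (0# <_) (sym (+-identityʳ 1#)) 0<1
  0<suc· (suc n) = <-trans (0<suc· n) (subst (_< 1# + suc n · 1#) (+-identityˡ _) (+-mono-< (suc n · 1#) 0<1))

  -- An ordered field has characteristic zero, because positive multiples of 1 are positive. This
  -- makes integer pivots invertible among the reals.
  ι≢0 : ∀ x → x ≢ 0ℤ → ι x ≢ 0#
  ι≢0 (+ zero)  x≢0 eq = x≢0 refl
  ι≢0 (+ suc n) x≢0 eq = irrefl (sym eq) (0<suc· n)
  ι≢0 -[1+ n ]  x≢0 eq = irrefl (trans (sym -0#≈0#) (trans (cong -_ (sym eq)) (-‿involutive _))) (0<suc· n)

  *-cancel-0 : ∀ {x y} → x ≢ 0# → x * y ≡ 0# → y ≡ 0#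
  *-cancel-0 {x} {y} x≢0 xy≡0 = begin
    y                   ≡⟨ *-identityˡ y ⟨
    1# * y              ≡⟨ cong (_* y) (trans (*-comm _ x) (inv-inverse x x≢0)) ⟨
    inv x x≢0 * x * y   ≡⟨ *-assoc (inv x x≢0) x y ⟩
    inv x x≢0 * (x * y) ≡⟨ trans (cong (inv x x≢0 *_) xy≡0) (zeroʳ _) ⟩
    0#                  ∎
    where open ≡-Reasoning

  -- From real to integer solutions of integral linear systems

  module ℝForms = LinearForms commutativeRing ι refl (+-identityʳ 1#) ι-homo

  -- Gaussian elimination, by induction on the number of unknowns. The real solution certifies that
  -- each reduced system still has a nonzero solution; the integer solution need not be close to it.
  integer-solution : ∀ n (E : List (Fin n → ℤ)) (v : Fin n → Carrier) →
    (∀ e → e ∈ E → ℝForms.dot e v ≡ 0#) → (∃ λ i → v i ≢ 0#) →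
    ∃ λ (w : Fin n → ℤ) → (∃ λ i → w i ≢ 0ℤ) × (∀ e → e ∈ E → ℤForms.dot e w ≡ 0ℤ)
  integer-solution zero    E v sol (() , _)
  integer-solution (suc n) E v sol (i , vi≢0) with Any.any? (λ e → ¬? (e zero I.≟ 0ℤ)) E
  -- No equation involves the first unknown, so that one may be 1 and the others 0.
  ... | no none = δ zero , (zero , λ ()) , λ e e∈ →
    trans (cong₂ (λ x y → x I.* 1ℤ I.+ y) (decidable-stable (e zero I.≟ 0ℤ) (λ e₀≢0 → none (lose e∈ e₀≢0)))
      (ℤForms.dot-zeroʳ (e ∘ suc) (λ _ → 0ℤ) (λ _ → refl))) refl
  ... | yes some with pivot , pivot∈ , p₀≢0 ← find some = extend (integer-solution n (map eliminate E) (v ∘ suc) sol′ nonzero)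
    where
    open ≡-Reasoning
    p₀ = pivot zero
    p  = pivot ∘ suc
    -- Elimination by cross-multiplication, which keeps the coefficients integral.
    eliminate : (Fin (suc n) → ℤ) → Fin n → ℤ
    eliminate e i = p₀ I.* e (suc i) I.+ (I.- e zero) I.* p i

    sol′ : ∀ f → f ∈ map eliminate E → ℝForms.dot f (v ∘ suc) ≡ 0#
    sol′ f f∈ with e , e∈ , refl ← ∈-map⁻ eliminate f∈ = begin
      ℝForms.dot (eliminate e) (v ∘ suc)
        ≡⟨ ℝForms.dot-combine p₀ (I.- e zero) (e ∘ suc) p (v ∘ suc) ⟩
      ι p₀ * Eᵥ e + ι⁻ e * Pᵥ
        -- Adding a zero multiple of p₀ v₀ restores the terms of the first unknown, so that the full
        -- forms `e` and `pivot` reappear.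
        ≡⟨ trans (cong (_+ (ι p₀ * Eᵥ e + ι⁻ e * Pᵥ)) (trans (cong (_* (ι p₀ * v zero)) (cancel e)) (zeroˡ _))) (+-identityˡ _) ⟨
      (ι (e zero) + ι⁻ e) * (ι p₀ * v zero) + (ι p₀ * Eᵥ e + ι⁻ e * Pᵥ)
        ≡⟨ solve 6 (λ e n p v E P → (e :+ n) :* (p :* v) :+ (p :* E :+ n :* P) := p :* (e :* v :+ E) :+ n :* (p :* v :+ P)) refl
             (ι (e zero)) (ι⁻ e) (ι p₀) (v zero) (Eᵥ e) Pᵥ ⟩
      ι p₀ * ℝForms.dot e v + ι⁻ e * ℝForms.dot pivot v
        ≡⟨ cong₂ (λ x y → ι p₀ * x + ι⁻ e * y) (sol e e∈) (sol pivot pivot∈) ⟩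
      ι p₀ * 0# + ι⁻ e * 0#
        ≡⟨ trans (cong₂ _+_ (zeroʳ _) (zeroʳ _)) (+-identityˡ 0#) ⟩
      0# ∎
      where
      open SemiringSolver commutativeSemiring using (solve; _:=_; _:+_; _:*_)
      Pᵥ = ℝForms.dot p (v ∘ suc)
      Eᵥ : (Fin (suc n) → ℤ) → Carrier
      Eᵥ e = ℝForms.dot (e ∘ suc) (v ∘ suc)
      ι⁻ : (Fin (suc n) → ℤ) → Carrier
      ι⁻ e = ι (I.- e zero)
      cancel : ∀ e → ι (e zero) + ι⁻ e ≡ 0#
      cancel e = trans (cong (λ x → ι (e zero) + x) (ι-neg (e zero))) (-‿inverseʳ _)

    nonzero : ∃ λ j → v (suc j) ≢ 0#
    nonzero with FinP.any? (λ j → ¬? (v (suc j) ≟ 0#))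
    ... | yes found = found
    ... | no none   = contradiction (all-zero i) vi≢0
      where
      tail-zero : ∀ j → v (suc j) ≡ 0#
      tail-zero j = decidable-stable (v (suc j) ≟ 0#) (λ vj≢0 → none (j , vj≢0))
      all-zero : ∀ i → v i ≡ 0#
      -- If all other unknowns vanish, the pivot equation reduces to p₀ v₀ = 0.
      all-zero zero    = *-cancel-0 (ι≢0 p₀ p₀≢0) (begin
        ι p₀ * v zero                              ≡⟨ +-identityʳ _ ⟨
        ι p₀ * v zero + 0#                         ≡⟨ cong (λ x → ι p₀ * v zero + x) (ℝForms.dot-zeroʳ p (v ∘ suc) tail-zero) ⟨
        ℝForms.dot pivot v                         ≡⟨ sol pivot pivot∈ ⟩
        0#                                         ∎)
      all-zero (suc j) = tail-zero j

    extend : (∃ λ (w : Fin n → ℤ) → (∃ λ i → w i ≢ 0ℤ) × (∀ e → e ∈ map eliminate E → ℤForms.dot e w ≡ 0ℤ)) →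
      ∃ λ (w : Fin (suc n) → ℤ) → (∃ λ i → w i ≢ 0ℤ) × (∀ e → e ∈ E → ℤForms.dot e w ≡ 0ℤ)
    extend (w , (j , wj≢0) , sol-w) = w⁺ , (suc j , p₀wj≢0) , λ e e∈ → begin
      e zero I.* (I.- ℤForms.dot p w) I.+ ℤForms.dot (e ∘ suc) (λ i → p₀ I.* w i)
        ≡⟨ cong (λ x → e zero I.* (I.- ℤForms.dot p w) I.+ x) (ℤForms.dot-scale (e ∘ suc) p₀ w) ⟩
      e zero I.* (I.- ℤForms.dot p w) I.+ p₀ I.* ℤForms.dot (e ∘ suc) w
        ≡⟨ lemma (e zero) (ℤForms.dot p w) p₀ (ℤForms.dot (e ∘ suc) w) ⟩
      p₀ I.* ℤForms.dot (e ∘ suc) w I.+ (I.- e zero) I.* ℤForms.dot p w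
        ≡⟨ ℤForms.dot-combine p₀ (I.- e zero) (e ∘ suc) p w ⟨
      ℤForms.dot (eliminate e) w
        ≡⟨ sol-w (eliminate e) (∈-map⁺ eliminate e∈) ⟩
      0ℤ ∎
      where
      w⁺ : Fin (suc n) → ℤ
      -- Back-substitution would give -(p · w)/p₀; scaling the whole solution by `p₀` clears the
      -- denominator.
      w⁺ zero    = I.- ℤForms.dot p w
      w⁺ (suc i) = p₀ I.* w i
      p₀wj≢0 : p₀ I.* w j ≢ 0ℤ
      p₀wj≢0 eq with ℤP.i*j≡0⇒i≡0∨j≡0 p₀ eq
      ... | inj₁ p₀≡0 = p₀≢0 p₀≡0
      ... | inj₂ wj≡0 = wj≢0 wj≡0
      lemma : ∀ e P p E → e I.* (I.- P) I.+ p I.* E ≡ p I.* E I.+ (I.- e) I.* P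
      lemma = ℤSolver.solve-∀

  -- Labellings of a finite list of reals

  PreservesMidpoints : List Carrier → (Carrier → ℤ) → Set
  PreservesMidpoints S ψ = ∀ {a b c} → a ∈ S → b ∈ S → c ∈ S → a + b ≡ c + c → ψ a I.+ ψ b ≡ ψ c I.+ ψ c

  -- The unknowns are the labels of the positions of `S`. Translation by `s` preserves midpoint
  -- relations, so the entries minus `s` form a real solution, nonzero at `x`.
  nonconstant-labelling : ∀ {S s x} → s ∈ S → x ∈ S → x ≢ s →
    ∃ λ ψ → PreservesMidpoints S ψ × ψ s ≡ 0ℤ × ∃ λ y → y ∈ S × ψ y ≢ 0ℤ
  nonconstant-labelling {S} {s} {x} s∈S x∈S x≢s = label (integer-solution (length S) forms v holds (Any.index x∈S , vx≢0))
    where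
    Index = Fin (length S)
    v : Index → Carrier
    v i = lookup S i + - s
    Mid : Index × Index × Index → Set
    Mid (i , j , k) = lookup S i + lookup S j ≡ lookup S k + lookup S k
    mid? : ∀ ijk → Dec (Mid ijk)
    mid? (i , j , k) = (lookup S i + lookup S j) ≟ (lookup S k + lookup S k)
    form : Index × Index × Index → Index → ℤ
    form (i , j , k) = midpointForm i j k
    triples = cartesianProduct (allFin (length S)) (cartesianProduct (allFin (length S)) (allFin (length S)))
    -- The first form pins the label of `s` to 0, so a nonzero solution is a nonconstant labelling.
    forms = δ (Any.index s∈S) ∷ map form (filter mid? triples)

    mid∈ : ∀ {i j k} → Mid (i , j , k) → midpointForm i j k ∈ forms
    mid∈ {i} {j} {k} m = there (∈-map⁺ form (∈-filter⁺ mid?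
      (∈-cartesianProduct⁺ (∈-allFin i) (∈-cartesianProduct⁺ (∈-allFin j) (∈-allFin k))) m))

    vx≢0 : v (Any.index x∈S) ≢ 0#
    vx≢0 eq = x≢s (trans (lookup-index x∈S) (x∙y⁻¹≈ε⇒x≈y _ _ eq))

    ι-double : ∀ y → y + y + ι (I.- + 2) * y ≡ 0#
    ι-double y = begin
      y + y + ι (I.- + 2) * y              ≡⟨ cong (_+ ι (I.- + 2) * y) two ⟨
      ι (+ 2) * y + ι (I.- + 2) * y        ≡⟨ distribʳ y (ι (+ 2)) (ι (I.- + 2)) ⟨
      (ι (+ 2) + ι (I.- + 2)) * y          ≡⟨ cong (_* y) (-‿inverseʳ (ι (+ 2))) ⟩
      0# * y                               ≡⟨ zeroˡ y ⟩
      0#                                   ∎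
      where
      open ≡-Reasoning
      open SemiringSolver commutativeSemiring using (solve; _:=_; _:+_; _:*_; con)
      two : ι (+ 2) * y ≡ y + y
      two = solve 1 (λ y → (con 1 :+ (con 1 :+ con 0)) :* y := y :+ y) refl y

    holds : ∀ e → e ∈ forms → ℝForms.dot e v ≡ 0#
    holds e (here refl) = trans (ℝForms.dot-δ (Any.index s∈S) v)
      (trans (cong (_+ - s) (sym (lookup-index s∈S))) (-‿inverseʳ s))
    holds e (there e∈) with (i , j , k) , ijk∈ , refl ← ∈-map⁻ form e∈ = begin
      ℝForms.dot (midpointForm i j k) v       ≡⟨ ℝForms.dot-midpoint i j k v ⟩
      v i + v j + ι (I.- + 2) * v k           ≡⟨ cong (_+ ι (I.- + 2) * v k) (shift i j k (proj₂ (∈-filter⁻ mid? {xs = triples} ijk∈))) ⟩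
      v k + v k + ι (I.- + 2) * v k           ≡⟨ ι-double (v k) ⟩
      0#                                      ∎
      where
      open ≡-Reasoning
      shift : ∀ i j k → Mid (i , j , k) → v i + v j ≡ v k + v k
      shift i j k m = trans (interchange _ _ _ _) (trans (cong (_+ (- s + - s)) m) (interchange _ _ _ _))

    label : (∃ λ (w : Index → ℤ) → (∃ λ i → w i ≢ 0ℤ) × (∀ e → e ∈ forms → ℤForms.dot e w ≡ 0ℤ)) →
      ∃ λ ψ → PreservesMidpoints S ψ × ψ s ≡ 0ℤ × ∃ λ y → y ∈ S × ψ y ≢ 0ℤ
    label (w , (i , wi≢0) , sol) = ψ , preserves , ψs≡0 , lookup S i , ∈-lookup i , λ ψ≡0 →
        wi≢0 (trans (well-defined (proj₁ (proj₂ (ψ-index (∈-lookup i))))) (trans (sym (proj₂ (proj₂ (ψ-index (∈-lookup i))))) ψ≡0))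
      where
      w-mid : ∀ {i j k} → Mid (i , j , k) → w i I.+ w j ≡ w k I.+ w k
      w-mid {i} {j} {k} m = ℤP.i-j≡0⇒i≡j _ _ (trans (lemma (w i) (w j) (w k))
        (trans (sym (ℤForms.dot-midpoint i j k w)) (sol (midpointForm i j k) (mid∈ {i} {j} {k} m))))
        where
        lemma : ∀ x y z → (x I.+ y) I.- (z I.+ z) ≡ x I.+ y I.+ (I.- + 2) I.* z
        lemma = ℤSolver.solve-∀
      -- `S` may repeat a point. If positions `i` and `j` carry the same point, then (i , i , j) is
      -- a midpoint triple, whence 2 w i = 2 w j.
      well-defined : ∀ {i j} → lookup S i ≡ lookup S j → w i ≡ w j
      well-defined {i} {j} eq = ℤP.*-cancelʳ-≡ (w i) (w j) (+ 2)
        (trans (sym (double (w i))) (trans (w-mid (cong₂ _+_ eq eq)) (double (w j))))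
      ψ : Carrier → ℤ
      ψ y with Any.any? (y ≟_) S
      ... | yes y∈ = w (Any.index y∈)
      ... | no _   = 0ℤ
      ψ-index : ∀ {y} → y ∈ S → ∃ λ i → y ≡ lookup S i × ψ y ≡ w i
      ψ-index {y} y∈ with Any.any? (y ≟_) S
      ... | yes y∈′ = Any.index y∈′ , lookup-index y∈′ , refl
      ... | no y∉   = contradiction y∈ y∉
      preserves : PreservesMidpoints S ψ
      preserves a∈ b∈ c∈ eq with ψ-index a∈ | ψ-index b∈ | ψ-index c∈
      ... | i , a≡ , ψa | j , b≡ , ψb | k , c≡ , ψc =
        trans (cong₂ I._+_ ψa ψb) (trans (w-mid (trans (sym (cong₂ _+_ a≡ b≡)) (trans eq (cong₂ _+_ c≡ c≡)))) (sym (cong₂ I._+_ ψc ψc)))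
      ψs≡0 : ψ s ≡ 0ℤ
      ψs≡0 with ψ-index s∈S
      ... | i , s≡ , ψs = trans ψs (trans (well-defined (trans (sym s≡) (lookup-index s∈S)))
        (trans (sym (ℤForms.dot-δ (Any.index s∈S) w)) (sol _ (here refl))))

  nonconstant-parity-labelling : ∀ {S s x} → s ∈ S → x ∈ S → x ≢ s →
    ∃ λ ψ → PreservesMidpoints S ψ × bit (ψ s) ≡ false × ∃ λ y → y ∈ S × bit (ψ y) ≡ true
  nonconstant-parity-labelling {S} {s} s∈ x∈ x≢s =
    let ψ , pres , ψs≡0 , y , y∈ , ψy≢0 = nonconstant-labelling s∈ x∈ x≢s
    in descend y∈ I.∣ ψ y ∣ ψ pres ψs≡0 ψy≢0 ℕP.≤-refl
    where
    -- Halving an everywhere even labelling shrinks the nonzero value ψ y.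
    descend : ∀ {y} → y ∈ S → ∀ n ψ → PreservesMidpoints S ψ → ψ s ≡ 0ℤ → ψ y ≢ 0ℤ → I.∣ ψ y ∣ ℕ.≤ n →
      ∃ λ ψ → PreservesMidpoints S ψ × bit (ψ s) ≡ false × ∃ λ y → y ∈ S × bit (ψ y) ≡ true
    descend y∈ zero ψ pres ψs≡0 ψy≢0 ≤n = contradiction (ℤP.∣i∣≡0⇒i≡0 (ℕP.n≤0⇒n≡0 ≤n)) ψy≢0
    descend {y} y∈ (suc n) ψ pres ψs≡0 ψy≢0 ≤n with Any.any? (λ y → bit (ψ y) Bool.≟ true) S
    ... | yes some with y , y∈ , odd ← find some = ψ , pres , cong bit ψs≡0 , y , y∈ , odd
    ... | no none = descend y∈ n (half ∘ ψ) pres′ (cong half ψs≡0) half≢0 (ℕP.≤-pred (ℕP.<-≤-trans (half-smaller (ψ y) (even y∈) half≢0) ≤n))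
      where
      even : ∀ {y} → y ∈ S → bit (ψ y) ≡ false
      even {y} y∈ with bit (ψ y) in eq
      ... | false = refl
      ... | true  = contradiction (lose y∈ eq) none
      pres′ : PreservesMidpoints S (half ∘ ψ)
      pres′ {a} {b} {c} a∈ b∈ c∈ eq = trans (midpoint-half (ψ a) (ψ b) (ψ c) (pres a∈ b∈ c∈ eq) (even a∈) (even b∈))
        (trans (bit-even (ψ c) (even c∈)) (sym (double (half (ψ c)))))
      half≢0 : half (ψ y) ≢ 0ℤ
      half≢0 eq = ψy≢0 (trans (bit-even (ψ y) (even y∈)) (cong (I._* + 2) eq))

-- Peeling hooks and counting

open import Data.Nat using (_+_; _*_; _≤_)

PeelingBound : ℕ → ℕ → ℕ → ℕ → Set
PeelingBound a b h X = ∀ k i j → k + i ≡ a → k + j ≡ b → X ≤ k * h + i * j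

peeling-mono : ∀ {a b h h′ X} → h ≤ h′ → PeelingBound a b h X → PeelingBound a b h′ X
peeling-mono h≤h′ bound k i j eq₁ eq₂ = ℕP.≤-trans (bound k i j eq₁ eq₂) (ℕP.+-monoˡ-≤ (i * j) (ℕP.*-monoʳ-≤ k h≤h′))

-- Writes the two sides of a grid as `m` and m + s and records which one is shorter, so that the
-- optimisation can be done for ordered sides.
data Gap : ℕ → ℕ → ℕ → ℕ → Set where
  left  : ∀ {m s} → Gap m s m (m + s)
  right : ∀ {m s} → Gap m s (m + s) m

gap : ∀ a b → ∃₂ λ m s → Gap m s a b
gap a b with ℕP.≤-total a b
... | inj₁ a≤b = a , b ℕ.∸ a , subst (Gap a (b ℕ.∸ a) a) (ℕP.m+[n∸m]≡n a≤b) left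
... | inj₂ b≤a = b , a ℕ.∸ b , subst (λ x → Gap b (a ℕ.∸ b) x b) (ℕP.m+[n∸m]≡n b≤a) right

peeling⇒hook : ∀ {m s a b z X} → Gap m s a b → PeelingBound a b z X → Hook m s z X
peeling⇒hook {s = s} left  h k j refl = h k j (j + s) refl (sym (ℕP.+-assoc k j s))
peeling⇒hook {s = s} {z = z} {X} right h k j refl =
  subst (λ x → X ≤ k * z + x) (ℕP.*-comm (j + s) j) (h k (j + s) j (sym (ℕP.+-assoc k j s)) refl)

gap-sum : ∀ {m s a b} → Gap m s a b → a + b ≡ 2 * m + s
gap-sum {m} {s} left = lemma m s
  where
  lemma : ∀ m s → m + (m + s) ≡ 2 * m + s
  lemma = ℕSolver.solve-∀
gap-sum {m} {s} right = lemma m s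
  where
  lemma : ∀ m s → m + s + m ≡ 2 * m + s
  lemma = ℕSolver.solve-∀

-- The grids are α × β′ and α′ × β, whereas the pairs congruent mod 4 form α × β and α′ × β′.
-- Oppositely oriented gaps give equality; equal orientations lose the term s * t.
gap-product : ∀ {m n s t α α′ β β′} → Gap m s α β′ → Gap n t α′ β →
  α * β + α′ * β′ ≤ 2 * (m * n) + s * n + m * t + s * t
gap-product {m} {n} {s} {t} left left = ℕP.≤-trans (ℕP.≤-reflexive (lemma m n s t)) (ℕP.m≤m+n _ (s * t))
  where
  lemma : ∀ m n s t → m * (n + t) + n * (m + s) ≡ 2 * (m * n) + s * n + m * t
  lemma = ℕSolver.solve-∀
gap-product {m} {n} {s} {t} left right = ℕP.≤-reflexive (lemma m n s t)
  where
  lemma : ∀ m n s t → m * n + (n + t) * (m + s) ≡ 2 * (m * n) + s * n + m * t + s * t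
  lemma = ℕSolver.solve-∀
gap-product {m} {n} {s} {t} right left = ℕP.≤-reflexive (lemma m n s t)
  where
  lemma : ∀ m n s t → (m + s) * (n + t) + n * m ≡ 2 * (m * n) + s * n + m * t + s * t
  lemma = ℕSolver.solve-∀
gap-product {m} {n} {s} {t} right right = ℕP.≤-trans (ℕP.≤-reflexive (lemma m n s t)) (ℕP.m≤m+n _ (s * t))
  where
  lemma : ∀ m n s t → (m + s) * n + (n + t) * m ≡ 2 * (m * n) + s * n + m * t
  lemma = ℕSolver.solve-∀

4mn≤[m+n]² : ∀ m n → 4 * (m * n) ≤ (m + n) * (m + n)
4mn≤[m+n]² m n with gap m n
... | a , d , left = ℕP.≤-trans (ℕP.m≤m+n _ (d * d)) (ℕP.≤-reflexive (lemma a d))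
  where
  lemma : ∀ a d → 4 * (a * (a + d)) + d * d ≡ (a + (a + d)) * (a + (a + d))
  lemma = ℕSolver.solve-∀
... | a , d , right = ℕP.≤-trans (ℕP.m≤m+n _ (d * d)) (ℕP.≤-reflexive (lemma a d))
  where
  lemma : ∀ a d → 4 * ((a + d) * a) + d * d ≡ (a + d + a) * (a + d + a)
  lemma = ℕSolver.solve-∀

-- The optimisation in terms of class sizes: α, α′ and β, β′ are the classes 0 and 2 mod 4 of A and
-- of B, and `p`, `q` their numbers of odd points.
class-bound : ∀ α α′ β β′ p q T₁ T₀ X₁ X₂ →
  let z = p + q ; N = α + α′ + (β + β′) in
  1 ≤ z → z ≤ N → T₁ ≤ p * q → T₀ ≤ α * β + α′ * β′ → 20 * T₀ ≤ 3 * (N * N) + 10 * N →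
  PeelingBound α β′ z X₁ → PeelingBound α′ β z X₂ →
  20 * (T₁ + T₀ + X₁ + X₂) ≤ 3 * ((N + z) * (N + z)) + 10 * (N + z)
class-bound α α′ β β′ p q T₁ T₀ X₁ X₂ 1≤z z≤N h₁ h₀ ih x₁ x₂
  with m , s , g₁ ← gap α β′ | n , t , g₂ ← gap α′ β =
  subst (λ N → 20 * (T₁ + T₀ + X₁ + X₂) ≤ 3 * ((N + z) * (N + z)) + 10 * (N + z)) (sym N≡)
    (peeling-bound m n s t z T₁ T₀ X₁ X₂ 1≤z (subst (z ≤_) N≡ z≤N)
      (ℕP.≤-trans (ℕP.*-monoʳ-≤ 4 h₁) (4mn≤[m+n]² p q))
      (ℕP.≤-trans h₀ (gap-product g₁ g₂))
      (subst (λ N → 20 * T₀ ≤ 3 * (N * N) + 10 * N) N≡ ih)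
      (peeling⇒hook g₁ x₁) (peeling⇒hook g₂ x₂))
  where
  z = p + q
  rearrange : ∀ a a′ b b′ → a + a′ + (b + b′) ≡ a + b′ + (a′ + b)
  rearrange = ℕSolver.solve-∀
  N≡ : α + α′ + (β + β′) ≡ 2 * m + s + (2 * n + t)
  N≡ = trans (rearrange α α′ β β′) (cong₂ _+_ (gap-sum g₁) (gap-sum g₂))

-- Sums over lists

private variable
  X Y : Set

𝟙 : {P : Set} → Dec P → ℕ
𝟙 d = if does d then 1 else 0

𝟙-no : {P : Set} (d : Dec P) → ¬ P → 𝟙 d ≡ 0
𝟙-no (yes p) ¬p = contradiction p ¬p
𝟙-no (no _)  _  = refl

∑ : List X → (X → ℕ) → ℕ
∑ xs f = sum (map f xs)

∑-mono : ∀ (xs : List X) {f g : X → ℕ} → (∀ x → x ∈ xs → f x ≤ g x) → ∑ xs f ≤ ∑ xs g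
∑-mono []       h = z≤n
∑-mono (x ∷ xs) h = ℕP.+-mono-≤ (h x (here refl)) (∑-mono xs (λ y → h y ∘ there))

∑-cong : ∀ (xs : List X) {f g : X → ℕ} → (∀ x → f x ≡ g x) → ∑ xs f ≡ ∑ xs g
∑-cong xs h = cong sum (map-cong h xs)

∑-zero : ∀ (xs : List X) {f : X → ℕ} → (∀ x → x ∈ xs → f x ≡ 0) → ∑ xs f ≡ 0
∑-zero []       h = refl
∑-zero (x ∷ xs) h = cong₂ _+_ (h x (here refl)) (∑-zero xs (λ y → h y ∘ there))

∑-const : ∀ (xs : List X) k → ∑ xs (λ _ → k) ≡ length xs * k
∑-const []       k = refl
∑-const (x ∷ xs) k = cong (λ n → k + n) (∑-const xs k)

∑-+ : ∀ (xs : List X) (f g : X → ℕ) → ∑ xs (λ x → f x + g x) ≡ ∑ xs f + ∑ xs g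
∑-+ []       f g = refl
∑-+ (x ∷ xs) f g = trans (cong (λ n → f x + g x + n) (∑-+ xs f g)) (interchange (f x) (g x) (∑ xs f) (∑ xs g))
  where open import Algebra.Properties.CommutativeSemigroup ℕP.+-commutativeSemigroup using (interchange)

∑-swap : ∀ (xs : List X) (ys : List Y) (f : X → Y → ℕ) →
  ∑ xs (λ x → ∑ ys (f x)) ≡ ∑ ys (λ y → ∑ xs (λ x → f x y))
∑-swap []       ys f = sym (∑-zero ys (λ _ _ → refl))
∑-swap (x ∷ xs) ys f = trans (cong (λ n → ∑ ys (f x) + n) (∑-swap xs ys f)) (sym (∑-+ ys (f x) _))

∑-↭ : ∀ {xs ys : List X} (f : X → ℕ) → xs ↭ ys → ∑ xs f ≡ ∑ ys f
∑-↭ f p = sum-↭ (map⁺ f p)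

∑-++ : ∀ (xs ys : List X) (f : X → ℕ) → ∑ (xs ++ ys) f ≡ ∑ xs f + ∑ ys f
∑-++ xs ys f = trans (cong sum (map-++ f xs ys)) (sum-++ (map f xs) (map f ys))

∑-map : ∀ (xs : List X) (g : X → Y) (f : Y → ℕ) → ∑ (map g xs) f ≡ ∑ xs (f ∘ g)
∑-map []       g f = refl
∑-map (x ∷ xs) g f = cong (λ n → f (g x) + n) (∑-map xs g f)

∑-cartesianProduct : ∀ (xs : List X) (ys : List Y) (f : X × Y → ℕ) →
  ∑ (cartesianProduct xs ys) f ≡ ∑ xs (λ x → ∑ ys (λ y → f (x , y)))
∑-cartesianProduct []       ys f = refl
∑-cartesianProduct (x ∷ xs) ys f =
  trans (∑-++ (map (x ,_) ys) _ f) (cong₂ _+_ (∑-map ys (x ,_) f) (∑-cartesianProduct xs ys f))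

length-filter≡∑ : {P : X → Set} (P? : Decidable P) (xs : List X) → length (filter P? xs) ≡ ∑ xs (λ x → 𝟙 (P? x))
length-filter≡∑ P? [] = refl
length-filter≡∑ P? (x ∷ xs) with does (P? x)
... | true  = cong suc (length-filter≡∑ P? xs)
... | false = length-filter≡∑ P? xs

∑-𝟙-≤1 : {P : X → Set} (P? : Decidable P) {xs : List X} → Unique xs →
  (∀ x y → P x → P y → x ≡ y) → ∑ xs (λ x → 𝟙 (P? x)) ≤ 1
∑-𝟙-≤1 P? [] inj = z≤n
∑-𝟙-≤1 P? {x ∷ xs} (x∉xs ∷ u) inj with P? x
... | no _  = ∑-𝟙-≤1 P? u inj
... | yes p = ℕP.≤-reflexive (cong suc (∑-zero xs λ y y∈ → 𝟙-no (P? y) λ q → All.lookup x∉xs y∈ (inj x y p q)))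

module _ (_≟_ : DecidableEquality X) where

  -- Double counting of equal pairs: every entry of `xs` meets at least one entry of `ys`, and every
  -- entry of `ys` at most one of `xs`.
  length-⊆ : {xs ys : List X} → Unique xs → (∀ x → x ∈ xs → x ∈ ys) → length xs ≤ length ys
  length-⊆ {xs} {ys} u xs⊆ys = begin
    length xs                             ≡⟨ ℕP.*-identityʳ _ ⟨
    length xs * 1                         ≡⟨ ∑-const xs 1 ⟨
    ∑ xs (λ _ → 1)                        ≤⟨ ∑-mono xs (λ x x∈ → occurs x ys (xs⊆ys x x∈)) ⟩
    ∑ xs (λ x → ∑ ys (λ y → 𝟙 (x ≟ y)))   ≡⟨ ∑-swap xs ys _ ⟩
    ∑ ys (λ y → ∑ xs (λ x → 𝟙 (x ≟ y)))   ≤⟨ ∑-mono ys (λ y _ → ∑-𝟙-≤1 (_≟ y) u (λ _ _ p q → trans p (sym q))) ⟩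
    ∑ ys (λ _ → 1)                        ≡⟨ ∑-const ys 1 ⟩
    length ys * 1                         ≡⟨ ℕP.*-identityʳ _ ⟩
    length ys                             ∎
    where
    open ℕP.≤-Reasoning
    occurs : ∀ x ys → x ∈ ys → 1 ≤ ∑ ys (λ y → 𝟙 (x ≟ y))
    occurs x (y ∷ ys) (here x≡y) with x ≟ y
    ... | yes _   = s≤s z≤n
    ... | no x≢y  = contradiction x≡y x≢y
    occurs x (y ∷ ys) (there x∈) = ℕP.≤-trans (occurs x ys x∈) (ℕP.m≤n+m _ _)

-- Splitting a list by a Boolean label

class : (X → Bool) → Bool → List X → List X
class p b = filter (λ x → p x Bool.≟ b)

∈-class : ∀ (p : X → Bool) b {xs x} → x ∈ class p b xs → x ∈ xs × p x ≡ b
∈-class p b = ∈-filter⁻ (λ x → p x Bool.≟ b)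

∈-class⁺ : ∀ (p : X → Bool) b {xs x} → x ∈ xs → p x ≡ b → x ∈ class p b xs
∈-class⁺ p b = ∈-filter⁺ (λ x → p x Bool.≟ b)

class-unique : ∀ (p : X → Bool) b {xs} → Unique xs → Unique (class p b xs)
class-unique p b = UniqueP.filter⁺ (λ x → p x Bool.≟ b)

-- Serves the shift of labels by one, which exchanges odd and even points.
class-not : ∀ (p q : X → Bool) → (∀ x → q x ≡ not (p x)) → ∀ b xs → class q (not b) xs ≡ class p b xs
class-not p q q≡not-p b = filter-≐ (λ x → q x Bool.≟ not b) (λ x → p x Bool.≟ b)
  ((λ {x} q≡ → not-injective (trans (sym (q≡not-p x)) q≡)) , (λ {x} p≡ → trans (q≡not-p x) (cong not p≡)))

∑-class : ∀ (p : X → Bool) xs (f : X → ℕ) → ∑ xs f ≡ ∑ (class p false xs) f + ∑ (class p true xs) f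
∑-class p [] f = refl
∑-class p (x ∷ xs) f with p x
... | false = trans (cong (λ n → f x + n) (∑-class p xs f)) (sym (ℕP.+-assoc (f x) _ _))
... | true  = trans (cong (λ n → f x + n) (∑-class p xs f)) (x∙yz≈y∙xz (f x) (∑ (class p false xs) f) _)
  where open import Algebra.Properties.CommutativeSemigroup ℕP.+-commutativeSemigroup using (x∙yz≈y∙xz)

length-class : ∀ (p : X → Bool) xs → length xs ≡ length (class p false xs) + length (class p true xs)
length-class p xs = begin
  length xs                                                    ≡⟨ length≡∑ xs ⟩
  ∑ xs (λ _ → 1)                                               ≡⟨ ∑-class p xs _ ⟩
  ∑ (class p false xs) (λ _ → 1) + ∑ (class p true xs) (λ _ → 1) ≡⟨ cong₂ _+_ (length≡∑ (class p false xs)) (length≡∑ (class p true xs)) ⟨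
  length (class p false xs) + length (class p true xs)         ∎
  where
  open ≡-Reasoning
  length≡∑ : ∀ xs → length xs ≡ ∑ xs (λ _ → 1)
  length≡∑ xs = sym (trans (∑-const xs 1) (ℕP.*-identityʳ _))

-- The order is a parameter because the reversed order yields the maximum of `A`, and the given one
-- the minimum of `B`.
module Extremum {_<_ : X → X → Set} (<-trans : ∀ {x y z} → x < y → y < z → x < z) (compare : Trichotomous _≡_ _<_) where

  extract-min : ∀ x xs → Unique (x ∷ xs) → ∃₂ λ y ys → x ∷ xs ↭ y ∷ ys × All (y <_) ys
  extract-min x [] u = x , [] , ↭-refl , []
  extract-min x (x′ ∷ xs) (x∉ ∷ u) with extract-min x′ xs u
  ... | y , ys , perm , y<ys with compare x y
  ...   | tri< x<y _ _ = x , y ∷ ys , ↭-prep x perm , x<y ∷ All.map (<-trans x<y) y<ys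
  ...   | tri≈ _ x≡y _ = contradiction x≡y (All.head (All-resp-↭ perm x∉))
  ...   | tri> _ _ y<x = y , x ∷ ys , ↭-trans (↭-prep x perm) (↭-swap x y ↭-refl) , y<x ∷ y<ys

-- Counting midpoint triples and peeling hooks

module Midpoints (ℝ : RealField) where
  open RealField ℝ using (Carrier; _≟_; _<_; isStrictTotalOrder; isCommutativeRing; +-mono-<)
    renaming (_+_ to _+ᴿ_)
  open import Relation.Binary.Structures using (IsStrictTotalOrder)
  open import Algebra.Structures using (IsCommutativeRing)
  open IsStrictTotalOrder isStrictTotalOrder using (compare; irrefl) renaming (trans to <-trans)
  open IsCommutativeRing isCommutativeRing using () renaming (+-comm to +ᴿ-comm)

  +-monoʳ-<ᴿ : ∀ x {y z} → y < z → x +ᴿ y < x +ᴿ z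
  +-monoʳ-<ᴿ x {y} {z} y<z = subst₂ _<_ (+ᴿ-comm y x) (+ᴿ-comm z x) (+-mono-< x y<z)

  strictly-monotone⇒injective : (f : Carrier → Carrier) → (∀ {x y} → x < y → f x < f y) → ∀ x y → f x ≡ f y → x ≡ y
  strictly-monotone⇒injective f mono x y fx≡fy with compare x y
  ... | tri< x<y _ _ = contradiction (mono x<y) (irrefl fx≡fy)
  ... | tri≈ _ x≡y _ = x≡y
  ... | tri> _ _ y<x = contradiction (mono y<x) (irrefl (sym fx≡fy))

  double-injective : ∀ x y → x +ᴿ x ≡ y +ᴿ y → x ≡ y
  double-injective = strictly-monotone⇒injective (λ x → x +ᴿ x) (λ {x} {y} x<y → <-trans (+-monoʳ-<ᴿ x x<y) (+-mono-< y x<y))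

  χ : Carrier → Carrier → Carrier → ℕ
  χ a b c = 𝟙 ((a +ᴿ b) ≟ (c +ᴿ c))

  midpoints : List Carrier → List Carrier → List Carrier → ℕ
  midpoints A B C = ∑ A λ a → ∑ B λ b → ∑ C λ c → χ a b c

  tripleCount≡midpoints : ∀ A B → tripleCount ℝ A B ≡ midpoints A B (union ℝ A B)
  tripleCount≡midpoints A B =
    trans (length-filter≡∑ _ (cartesianProduct A (cartesianProduct B (union ℝ A B))))
      (trans (∑-cartesianProduct A _ _) (∑-cong A λ a → ∑-cartesianProduct B _ _))

  midpoints≤* : ∀ A B {C} → Unique C → midpoints A B C ≤ length A * length B
  midpoints≤* A B {C} uC = begin
    midpoints A B C              ≤⟨ ∑-mono A (λ a _ → ∑-mono B λ b _ → ∑-𝟙-≤1 (λ c → (a +ᴿ b) ≟ (c +ᴿ c)) uC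
                                      λ c d p q → double-injective c d (trans (sym p) q)) ⟩
    ∑ A (λ _ → ∑ B (λ _ → 1))    ≡⟨ ∑-cong A (λ _ → trans (∑-const B 1) (ℕP.*-identityʳ _)) ⟩
    ∑ A (λ _ → length B)         ≡⟨ ∑-const A (length B) ⟩
    length A * length B          ∎
    where open ℕP.≤-Reasoning

  midpoints-zero : ∀ A B C → (∀ a b c → a ∈ A → b ∈ B → c ∈ C → a +ᴿ b ≢ c +ᴿ c) → midpoints A B C ≡ 0
  midpoints-zero A B C h = ∑-zero A λ a a∈ → ∑-zero B λ b b∈ → ∑-zero C λ c c∈ → 𝟙-no ((a +ᴿ b) ≟ (c +ᴿ c)) (h a b c a∈ b∈ c∈)

  midpoints-classˡ : ∀ p A B C → midpoints A B C ≡ midpoints (class p false A) B C + midpoints (class p true A) B C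
  midpoints-classˡ p A B C = ∑-class p A _

  midpoints-classᵐ : ∀ p A B C → midpoints A B C ≡ midpoints A (class p false B) C + midpoints A (class p true B) C
  midpoints-classᵐ p A B C = trans (∑-cong A λ a → ∑-class p B _) (∑-+ A _ _)

  midpoints-classʳ : ∀ p A B C → midpoints A B C ≡ midpoints A B (class p false C) + midpoints A B (class p true C)
  midpoints-classʳ p A B C = trans (∑-cong A λ a → trans (∑-cong B λ b → ∑-class p C _) (∑-+ B _ _)) (∑-+ A _ _)

  Unique-resp-↭ : ∀ {xs ys : List Carrier} → xs ↭ ys → Unique xs → Unique ys
  Unique-resp-↭ p = PermS.Unique-resp-↭ (setoid Carrier) (↭⇒↭ₛ p)

  -- As a exceeds A and b is below B, all sums in the row of a and the column of b differ.
  hook≤length : ∀ {a b A B C} → All (_< a) A → All (b <_) B → Unique A → Unique (b ∷ B) →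
    ∑ (b ∷ B) (λ b → ∑ C (χ a b)) + ∑ A (λ a → ∑ C (χ a b)) ≤ length C
  hook≤length {a} {b} {A} {B} {C} A<a b<B uA uB = begin
    ∑ (b ∷ B) (λ b → ∑ C (χ a b)) + ∑ A (λ a → ∑ C (χ a b))
      ≡⟨ cong₂ _+_ (∑-swap (b ∷ B) C _) (∑-swap A C _) ⟩
    ∑ C (λ c → ∑ (b ∷ B) (λ b → χ a b c)) + ∑ C (λ c → ∑ A (λ a → χ a b c))
      ≡⟨ ∑-+ C _ _ ⟨
    ∑ C (λ c → ∑ (b ∷ B) (λ b → χ a b c) + ∑ A (λ a → χ a b c))
      ≤⟨ ∑-mono C (λ c _ → at-most-one c) ⟩
    ∑ C (λ _ → 1)
      ≡⟨ trans (∑-const C 1) (ℕP.*-identityʳ _) ⟩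
    length C ∎
    where
    open ℕP.≤-Reasoning
    row : ∀ c → ∑ (b ∷ B) (λ b → χ a b c) ≤ 1
    row c = ∑-𝟙-≤1 (λ b → (a +ᴿ b) ≟ (c +ᴿ c)) uB
      λ b b′ p q → strictly-monotone⇒injective (a +ᴿ_) (+-monoʳ-<ᴿ a) b b′ (trans p (sym q))
    column : ∀ c → ∑ A (λ a → χ a b c) ≤ 1
    column c = ∑-𝟙-≤1 (λ a → (a +ᴿ b) ≟ (c +ᴿ c)) uA
      λ a a′ p q → strictly-monotone⇒injective (_+ᴿ b) (+-mono-< b) a a′ (trans p (sym q))
    b-least : ∀ {b′} → b′ ∈ b ∷ B → a +ᴿ b′ ≡ a +ᴿ b ⊎ a +ᴿ b < a +ᴿ b′
    b-least (here refl) = inj₁ refl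
    b-least (there b′∈) = inj₂ (+-monoʳ-<ᴿ a (All.lookup b<B b′∈))
    -- The chain a′ + b < a + b ≤ a + b′ separates the column from the row.
    disjoint : ∀ {a′ b′} → a′ ∈ A → b′ ∈ b ∷ B → a +ᴿ b′ ≢ a′ +ᴿ b
    disjoint {a′} a′∈ b′∈ eq with +-mono-< b (All.lookup A<a a′∈) | b-least b′∈
    ... | lt | inj₁ e   = irrefl (trans (sym eq) e) lt
    ... | lt | inj₂ lt′ = irrefl (sym eq) (<-trans lt lt′)
    at-most-one : ∀ c → ∑ (b ∷ B) (λ b → χ a b c) + ∑ A (λ a → χ a b c) ≤ 1
    -- If the column has a solution for `c`, the row has none; otherwise only the row can
    -- contribute.
    at-most-one c with Any.any? (λ a′ → (a′ +ᴿ b) ≟ (c +ᴿ c)) A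
    ... | yes some with a′ , a′∈ , eq ← find some =
      subst (λ x → x + ∑ A (λ a → χ a b c) ≤ 1)
        (sym (∑-zero (b ∷ B) λ b′ b′∈ → 𝟙-no ((a +ᴿ b′) ≟ (c +ᴿ c)) λ eq′ → disjoint a′∈ b′∈ (trans eq′ (sym eq)))) (column c)
    ... | no none = subst (_≤ 1)
        (sym (trans (cong (λ n → ∑ (b ∷ B) (λ b → χ a b c) + n)
               (∑-zero A λ a′ a′∈ → 𝟙-no ((a′ +ᴿ b) ≟ (c +ᴿ c)) λ eq → none (lose a′∈ eq))) (ℕP.+-identityʳ _))) (row c)

  -- Induction on the number of hooks: each costs at most |C| and shortens both sides by one. The
  -- remaining grid is bounded by its number of pairs, as a pair has at most one midpoint.
  midpoints-peeling : ∀ {A B C} → Unique A → Unique B → Unique C →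
    PeelingBound (length A) (length B) (length C) (midpoints A B C)
  midpoints-peeling {A} {B} uA uB uC zero i j refl refl = midpoints≤* A B uC
  midpoints-peeling {[]} uA uB uC (suc k) i j () _
  midpoints-peeling {x ∷ A} {[]} uA uB uC (suc k) i j _ ()
  midpoints-peeling {x ∷ A₀} {y ∷ B₀} {C} uA₀ uB₀ uC (suc k) i j eqA eqB
    with Extremum.extract-min {_<_ = λ x y → y < x} (λ p q → <-trans q p) compare⁻ x A₀ uA₀
       | Extremum.extract-min <-trans compare y B₀ uB₀
    where
    compare⁻ : Trichotomous _≡_ (λ x y → y < x)
    compare⁻ x y with compare x y
    ... | tri< a b c = tri> c b a
    ... | tri≈ a b c = tri≈ c b a
    ... | tri> a b c = tri< c b a
  ... | a , A , permA , A<a | b , B , permB , b<B = begin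
    midpoints (x ∷ A₀) (y ∷ B₀) C
      ≡⟨ trans (∑-↭ _ permA) (∑-cong (a ∷ A) λ a → ∑-↭ _ permB) ⟩
    midpoints (a ∷ A) (b ∷ B) C
      ≡⟨ cong (λ n → ∑ (b ∷ B) (λ b → ∑ C (χ a b)) + n) (∑-+ A _ _) ⟩
    ∑ (b ∷ B) (λ b → ∑ C (χ a b)) + (∑ A (λ a → ∑ C (χ a b)) + midpoints A B C)
      ≡⟨ ℕP.+-assoc (∑ (b ∷ B) (λ b → ∑ C (χ a b))) _ _ ⟨
    ∑ (b ∷ B) (λ b → ∑ C (χ a b)) + ∑ A (λ a → ∑ C (χ a b)) + midpoints A B C
      ≤⟨ ℕP.+-mono-≤ (hook≤length {a} {b} {A} {B} {C} A<a b<B uA uB)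
           (midpoints-peeling uA (AllPairs.tail uB) uC k i j
             (ℕP.suc-injective (trans eqA (↭-length permA))) (ℕP.suc-injective (trans eqB (↭-length permB)))) ⟩
    length C + (k * length C + i * j)
      ≡⟨ ℕP.+-assoc (length C) _ _ ⟨
    suc k * length C + i * j ∎
    where
    open ℕP.≤-Reasoning
    uA = AllPairs.tail (Unique-resp-↭ permA uA₀)
    uB = Unique-resp-↭ permB uB₀

-- Twenty times 0.15 N² + 0.5 N, which keeps everything in the natural numbers.
bound : ℕ → ℕ
bound N = 3 * (N * N) + 10 * N

∈⇒1≤length : ∀ {X : Set} {x : X} {xs} → x ∈ xs → 1 ≤ length xs
∈⇒1≤length (here _)  = s≤s z≤n
∈⇒1≤length (there _) = s≤s z≤n

-- Induction on the number of points

module _ (ℝ : RealField) where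
  open RealField ℝ using (Carrier; _≟_) renaming (_+_ to _+ᴿ_)
  open Midpoints ℝ
  open Labelling ℝ

  -- Inclusion of `C` in the union, rather than equality with `union`, passes directly to parity
  -- classes and suffices to bound |C|.
  Covered : List Carrier → List Carrier → List Carrier → Set
  Covered A B C = ∀ c → c ∈ C → c ∈ A ⊎ c ∈ B

  covered-class : ∀ (p : Carrier → Bool) b {A B C} → Covered A B C → Covered (class p b A) (class p b B) (class p b C)
  covered-class p b {C = C} cov c c∈ = let c∈C , pc = ∈-class p b {C} c∈ in
    Sum.map (λ c∈A → ∈-class⁺ p b c∈A pc) (λ c∈B → ∈-class⁺ p b c∈B pc) (cov c c∈C)

  covered-length : ∀ {A B C} → Unique C → Covered A B C → length C ≤ length A + length B
  covered-length {A} {B} {C} uC cov = subst (length C ≤_) (length-++ A {B})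
    (length-⊆ _≟_ {ys = A ++ B} uC (λ c c∈ → Sum.[ ∈-++⁺ˡ , ∈-++⁺ʳ A ]′ (cov c c∈)))

  midpoints-class₂ : ∀ p A B C → midpoints A B C ≡
    midpoints (class p false A) (class p false B) C + midpoints (class p false A) (class p true B) C
    + (midpoints (class p true A) (class p false B) C + midpoints (class p true A) (class p true B) C)
  midpoints-class₂ p A B C = trans (midpoints-classˡ p A B C)
    (cong₂ _+_ (midpoints-classᵐ p (class p false A) B C) (midpoints-classᵐ p (class p true A) B C))

  -- The inductive step, with labels reduced to their last two binary digits: `o` marks the odd
  -- points, and `t` splits the even ones mod 4.
  class-step : ∀ {A B C} (o t : Carrier → Bool) → Unique A → Unique B → Unique C → Covered A B C →
    (∀ {a b c} → a ∈ A → b ∈ B → c ∈ C → a +ᴿ b ≡ c +ᴿ c → o a ≡ o b) →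
    (∀ {a b c} → a ∈ A → b ∈ B → c ∈ C → a +ᴿ b ≡ c +ᴿ c → o a ≡ false → o b ≡ false → t a xor t b ≡ o c) →
    1 ≤ length (class o true A) + length (class o true B) →
    length (class o true A) + length (class o true B) ≤ length (class o false A) + length (class o false B) →
    20 * midpoints (class o false A) (class o false B) (class o false C)
      ≤ bound (length (class o false A) + length (class o false B)) →
    20 * midpoints A B C ≤ bound (length A + length B)
  class-step {A} {B} {C} o t uA uB uC cov parity second 1≤z z≤N ih = begin
    20 * midpoints A B C
      ≡⟨ cong (20 *_) decomposition ⟩
    20 * (M₁ + M₀ + X₁ + X₂)
      ≤⟨ class-bound (length A₀₀) (length A₀₁) (length B₀₀) (length B₀₁) (length A₁) (length B₁) M₁ M₀ X₁ X₂
           1≤z (subst (length A₁ + length B₁ ≤_) N≡ z≤N)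
           (midpoints≤* A₁ B₁ uC)
           (ℕP.≤-trans (ℕP.≤-reflexive M₀≡) (ℕP.+-mono-≤ (midpoints≤* A₀₀ B₀₀ uC₀) (midpoints≤* A₀₁ B₀₁ uC₀)))
           (subst (λ N → 20 * M₀ ≤ bound N) N≡ ih)
           (peeling-mono {h = length C₁} C₁≤z (midpoints-peeling (unique₂ false uA) (unique₂ true uB) uC₁))
           (peeling-mono {h = length C₁} C₁≤z (midpoints-peeling (unique₂ true uA) (unique₂ false uB) uC₁)) ⟩
    bound (length A₀₀ + length A₀₁ + (length B₀₀ + length B₀₁) + (length A₁ + length B₁))
      ≡⟨ cong bound (trans (cong (_+ (length A₁ + length B₁)) (sym N≡))
           (trans (interchange (length A₀) (length B₀) (length A₁) (length B₁)) (sym (cong₂ _+_ (length-class o A) (length-class o B))))) ⟩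
    bound (length A + length B) ∎
    where
    open ℕP.≤-Reasoning
    open import Algebra.Properties.CommutativeSemigroup ℕP.+-commutativeSemigroup using (interchange)
    A₀ = class o false A
    A₁ = class o true A
    B₀ = class o false B
    B₁ = class o true B
    C₀ = class o false C
    C₁ = class o true C
    A₀₀ = class t false A₀
    A₀₁ = class t true A₀
    B₀₀ = class t false B₀
    B₀₁ = class t true B₀
    M₁ = midpoints A₁ B₁ C
    M₀ = midpoints A₀ B₀ C₀
    X₁ = midpoints A₀₀ B₀₁ C₁
    X₂ = midpoints A₀₁ B₀₀ C₁

    uC₀ : Unique C₀
    uC₀ = class-unique o false uC
    uC₁ : Unique C₁
    uC₁ = class-unique o true uC
    unique₂ : ∀ b {D} → Unique D → Unique (class t b (class o false D))
    unique₂ b u = class-unique t b (class-unique o false u)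
    -- This lets a hook with odd midpoints be charged `z` solutions.
    C₁≤z : length C₁ ≤ length A₁ + length B₁
    C₁≤z = covered-length uC₁ (covered-class o true cov)
    N≡ : length A₀ + length B₀ ≡ length A₀₀ + length A₀₁ + (length B₀₀ + length B₀₁)
    N≡ = cong₂ _+_ (length-class t A₀) (length-class t B₀)

    parity-differs : ∀ x y → x ≢ y → midpoints (class o x A) (class o y B) C ≡ 0
    parity-differs x y x≢y = midpoints-zero (class o x A) (class o y B) C λ a b c a∈ b∈ c∈ eq →
      let a∈A , oa = ∈-class o x {A} a∈
          b∈B , ob = ∈-class o y {B} b∈
      in x≢y (trans (sym oa) (trans (parity a∈A b∈B c∈ eq) ob))

    second-differs : ∀ x y z → x xor y ≢ z →
      midpoints (class t x A₀) (class t y B₀) (class o z C) ≡ 0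
    second-differs x y z ≢z = midpoints-zero (class t x A₀) (class t y B₀) (class o z C) λ a b c a∈ b∈ c∈ eq →
      let a∈A₀ , ta = ∈-class t x {A₀} a∈
          b∈B₀ , tb = ∈-class t y {B₀} b∈
          a∈A , oa = ∈-class o false {A} a∈A₀
          b∈B , ob = ∈-class o false {B} b∈B₀
          c∈C , oc = ∈-class o z {C} c∈
      in ≢z (trans (sym (cong₂ _xor_ ta tb)) (trans (second a∈A b∈B c∈C eq oa ob) oc))

    -- Even midpoints force equal second digits and odd ones force different second digits; hence
    -- the diagonal blocks here and the two grids in `X≡`.
    M₀≡ : M₀ ≡ midpoints A₀₀ B₀₀ C₀ + midpoints A₀₁ B₀₁ C₀
    M₀≡ = trans (midpoints-class₂ t A₀ B₀ C₀) (cong₂ _+_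
      (trans (cong (λ n → midpoints A₀₀ B₀₀ C₀ + n) (second-differs false true false λ ())) (ℕP.+-identityʳ _))
      (cong (_+ midpoints A₀₁ B₀₁ C₀) (second-differs true false false λ ())))

    X≡ : midpoints A₀ B₀ C₁ ≡ X₁ + X₂
    X≡ = trans (midpoints-class₂ t A₀ B₀ C₁) (cong₂ _+_
      (cong (_+ X₁) (second-differs false false true λ ()))
      (trans (cong (λ n → X₂ + n) (second-differs true true true λ ())) (ℕP.+-identityʳ _)))

    decomposition : midpoints A B C ≡ M₁ + M₀ + X₁ + X₂
    decomposition = begin-equality
      midpoints A B C
        ≡⟨ midpoints-class₂ o A B C ⟩
      midpoints A₀ B₀ C + midpoints A₀ B₁ C + (midpoints A₁ B₀ C + M₁)
        ≡⟨ cong₂ (λ x y → midpoints A₀ B₀ C + x + (y + M₁)) (parity-differs false true λ ()) (parity-differs true false λ ()) ⟩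
      midpoints A₀ B₀ C + 0 + M₁
        ≡⟨ cong (λ x → x + 0 + M₁) (trans (midpoints-classʳ o A₀ B₀ C) (cong (λ n → M₀ + n) X≡)) ⟩
      M₀ + (X₁ + X₂) + 0 + M₁
        ≡⟨ rearrange M₀ X₁ X₂ M₁ ⟩
      M₁ + M₀ + X₁ + X₂ ∎
      where
      rearrange : ∀ m x y n → m + (x + y) + 0 + n ≡ n + m + x + y
      rearrange = ℕSolver.solve-∀

  class-nonempty : ∀ (p : Carrier → Bool) b A B {x} → x ∈ A ++ B → p x ≡ b → 1 ≤ length (class p b A) + length (class p b B)
  class-nonempty p b A B x∈ px with ∈-++⁻ A x∈
  ... | inj₁ x∈A = ℕP.≤-trans (∈⇒1≤length (∈-class⁺ p b x∈A px)) (ℕP.m≤m+n _ _)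
  ... | inj₂ x∈B = ℕP.≤-trans (∈⇒1≤length (∈-class⁺ p b x∈B px)) (ℕP.m≤n+m _ _)

  MidpointBound : ℕ → Set
  MidpointBound n = ∀ A B C → length A + length B ≤ n → Unique A → Unique B → Unique C → Covered A B C →
    20 * midpoints A B C ≤ bound (length A + length B)

  labelled-step : ∀ {n A B C} → MidpointBound n → length A + length B ≤ suc n →
    Unique A → Unique B → Unique C → Covered A B C →
    ∀ ψ → PreservesMidpoints (A ++ B) ψ → let o = bit ∘ ψ in (∃ λ y → y ∈ A ++ B × o y ≡ true) →
    length (class o true A) + length (class o true B) ≤ length (class o false A) + length (class o false B) →
    20 * midpoints A B C ≤ bound (length A + length B)
  labelled-step {n} {A} {B} {C} ih ≤n uA uB uC cov ψ pres (y , y∈ , odd) z≤N =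
    class-step o (bit ∘ half ∘ ψ) uA uB uC cov
      (λ {a} {b} {c} a∈ b∈ c∈ eq → midpoint-parity (ψ a) (ψ b) (ψ c) (relation a∈ b∈ c∈ eq))
      (λ {a} {b} {c} a∈ b∈ c∈ eq → midpoint-second-bit (ψ a) (ψ b) (ψ c) (relation a∈ b∈ c∈ eq))
      1≤z z≤N
      (ih (class o false A) (class o false B) (class o false C) smaller
        (class-unique o false uA) (class-unique o false uB) (class-unique o false uC) (covered-class o false cov))
    where
    open import Algebra.Properties.CommutativeSemigroup ℕP.+-commutativeSemigroup using (interchange)
    o = bit ∘ ψ
    relation : ∀ {a b c} → a ∈ A → b ∈ B → c ∈ C → a +ᴿ b ≡ c +ᴿ c → ψ a I.+ ψ b ≡ ψ c I.+ ψ c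
    relation a∈ b∈ c∈ = pres (∈-++⁺ˡ a∈) (∈-++⁺ʳ A b∈) (Sum.[ ∈-++⁺ˡ , ∈-++⁺ʳ A ]′ (cov _ c∈))
    1≤z : 1 ≤ length (class o true A) + length (class o true B)
    1≤z = class-nonempty o true A B y∈ odd
    -- Some point is odd, so at most `n` points are even and the induction hypothesis applies.
    smaller : length (class o false A) + length (class o false B) ≤ n
    smaller = ℕP.≤-pred (begin
      suc (length (class o false A) + length (class o false B))
        ≡⟨ ℕP.+-comm 1 _ ⟩
      length (class o false A) + length (class o false B) + 1
        ≤⟨ ℕP.+-monoʳ-≤ (length (class o false A) + length (class o false B)) 1≤z ⟩
      length (class o false A) + length (class o false B) + (length (class o true A) + length (class o true B))
        ≡⟨ interchange (length (class o false A)) (length (class o false B)) (length (class o true A)) (length (class o true B)) ⟩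
      length (class o false A) + length (class o true A) + (length (class o false B) + length (class o true B))
        ≡⟨ cong₂ _+_ (length-class o A) (length-class o B) ⟨
      length A + length B
        ≤⟨ ≤n ⟩
      suc n ∎)
      where open ℕP.≤-Reasoning

  shifted : ∀ {S ψ} → PreservesMidpoints S ψ → PreservesMidpoints S (λ x → ψ x I.+ 1ℤ)
  shifted {ψ = ψ} pres {a} {b} {c} a∈ b∈ c∈ eq =
    trans (lemma (ψ a) (ψ b)) (trans (cong (I._+ (1ℤ I.+ 1ℤ)) (pres a∈ b∈ c∈ eq)) (sym (lemma (ψ c) (ψ c))))
    where
    lemma : ∀ x y → (x I.+ 1ℤ) I.+ (y I.+ 1ℤ) ≡ (x I.+ y) I.+ (1ℤ I.+ 1ℤ)
    lemma = ℤSolver.solve-∀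

  midpoint-bound-singleton : ∀ {A B C s} → Unique A → Unique B → Unique C → (∀ {x} → x ∈ A ++ B → x ≡ s) →
    20 * midpoints A B C ≤ bound (length A + length B)
  midpoint-bound-singleton {A} {B} {C} {s} uA uB uC ≡s =
    ℕP.≤-trans (ℕP.*-monoʳ-≤ 20 (midpoints≤* A B uC)) (small (length A) (length B)
      (length-⊆ _≟_ {ys = s ∷ []} uA (λ x x∈ → here (≡s (∈-++⁺ˡ x∈))))
      (length-⊆ _≟_ {ys = s ∷ []} uB (λ x x∈ → here (≡s (∈-++⁺ʳ A x∈)))))
    where
    small : ∀ m n → m ≤ 1 → n ≤ 1 → 20 * (m * n) ≤ bound (m + n)
    small 0 n _ _ = z≤n
    small 1 0 _ _ = z≤n
    -- The single possible triple counts 20, and the bound for two points is 32.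
    small 1 1 _ _ = ℕP.m≤m+n 20 12
    small (suc (suc _)) _ (s≤s ()) _
    small 1 (suc (suc _)) _ (s≤s ())

  midpoint-bound : ∀ n → MidpointBound n
  midpoint-bound zero [] [] C _ _ _ _ _ = z≤n
  midpoint-bound (suc n) A B C ≤n uA uB uC cov = cases (A ++ B) refl
    where
    cases : ∀ S → A ++ B ≡ S → 20 * midpoints A B C ≤ bound (length A + length B)
    -- Without points any value serves as the common one; zero is at hand.
    cases [] eq = midpoint-bound-singleton {s = 0#} uA uB uC λ x∈ → contradiction (subst (_ ∈_) eq x∈) λ ()
      where open RealField ℝ using (0#)
    cases (s ∷ S) eq with Any.any? (λ x → ¬? (x ≟ s)) (A ++ B)
    ... | no none = midpoint-bound-singleton uA uB uC λ {x} x∈ → decidable-stable (x ≟ s) λ x≢s → none (lose x∈ x≢s)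
    ... | yes some with x , x∈ , x≢s ← find some =
      let ψ , pres , even , odd = nonconstant-parity-labelling s∈ x∈ x≢s
      in finish ψ pres even odd
      where
      s∈ : s ∈ A ++ B
      s∈ = subst (s ∈_) (sym eq) (here refl)
      finish : ∀ ψ → PreservesMidpoints (A ++ B) ψ → bit (ψ s) ≡ false → (∃ λ y → y ∈ A ++ B × bit (ψ y) ≡ true) →
        20 * midpoints A B C ≤ bound (length A + length B)
      finish ψ pres even odd with ℕP.≤-total (length (class (bit ∘ ψ) true A) + length (class (bit ∘ ψ) true B))
                                             (length (class (bit ∘ ψ) false A) + length (class (bit ∘ ψ) false B))
      ... | inj₁ z≤N = labelled-step (midpoint-bound n) ≤n uA uB uC cov ψ pres odd z≤N
      -- The odd points are the majority, so all labels are shifted by one; the even point `s`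
      -- becomes the required odd point.
      ... | inj₂ N≤z = labelled-step (midpoint-bound n) ≤n uA uB uC cov (λ x → ψ x I.+ 1ℤ) (shifted {ψ = ψ} pres)
              (s , s∈ , trans (bit-suc (ψ s)) (cong not even))
              (subst₂ _≤_ (sym (swap-class false)) (sym (swap-class true)) N≤z)
        where
        swap-class : ∀ b → length (class (λ x → bit (ψ x I.+ 1ℤ)) (not b) A) + length (class (λ x → bit (ψ x I.+ 1ℤ)) (not b) B)
          ≡ length (class (bit ∘ ψ) b A) + length (class (bit ∘ ψ) b B)
        swap-class b = cong₂ _+_ (cong length (class-not (bit ∘ ψ) _ (bit-suc ∘ ψ) b A))
                                 (cong length (class-not (bit ∘ ψ) _ (bit-suc ∘ ψ) b B))

theorem1 : (ℝ : RealField) (A B : List (RealField.Carrier ℝ)) →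
    Unique A → Unique B →
    20 * tripleCount ℝ A B ≤ 3 * ((length A + length B) * (length A + length B)) + 10 * (length A + length B)
theorem1 ℝ A B uA uB = subst (λ T → 20 * T ≤ bound (length A + length B)) (sym (tripleCount≡midpoints A B))
  (midpoint-bound ℝ (length A + length B) A B (union ℝ A B) ℕP.≤-refl uA uB (deduplicate-! _≟_ (A ++ B))
    (λ c c∈ → ∈-++⁻ A (∈-deduplicate⁻ _≟_ (A ++ B) c∈)))
  where
  open RealField ℝ using (_≟_)
  open Midpoints ℝ using (tripleCount≡midpoints)
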